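{- Let $l,m,n$ be positive integers, let $f_{11}(x),\dots,f_{1l}(x),f_{21}(x),\dots,f_{2m}(x),g_1(x),\dots,g_n(x)\in\mathbb{Z}[x]$, and let $\alpha_1,\dots,\alpha_l,\beta_1,\dots,\beta_m,\gamma_1,\dots,\gamma_n$ be positive integers. Let $$f(x)=f_{11}(x)^{\alpha_1}f_{12}(x)^{\alpha_2}\cdots f_{1l}(x)^{\alpha_l}\pm f_{21}(x)^{\beta_1}f_{22}(x)^{\beta_2}\cdots f_{2m}(x)^{\beta_m}$$ (with either choice of sign) and $$g(y)=g_1(y)^{\gamma_1}g_2(y)^{\gamma_2}\cdots g_n(y)^{\gamma_n}.$$ Suppose that: (1) $\deg g(y)>\deg f(x)$; (2) $\deg f(x)>1+\deg\bigl(f_{11}(x)f_{12}(x)\cdots f_{1l}(x)\,f_{21}(x)\cdots f_{2m}(x)\,g_1(x)\cdots g_n(x)\bigr)$; (3) $f_{11}(x)f_{12}(x)\cdots f_{1l}(x)$ and $f_{21}(x)\cdots f_{2m}(x)$ have no common factor in $\mathbb{Z}[x]$ (other than the units $\pm1$); (4) the leading coefficient of each of the products $f_{11}(x)\cdots f_{1l}(x)$, $f_{21}(x)\cdots f_{2m}(x)$, $g_1(x)\cdots g_n(x)$ is positive. If the $ABC$-Conjecture is assumed, then the equation $f(x)=g(y)$ has finitely many solutions $(x,y)$ in integers.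
   Context: The $ABC$-Conjecture is the following assertion: for every fixed $\epsilon>0$ there is a constant $C_\epsilon$ such that, whenever $a,b,c$ are coprime positive integers with $a+b=c$, one has $c\le C_\epsilon\,N(a,b,c)^{1+\epsilon}$, where $N(a,b,c)$ is the product of the distinct prime divisors of $abc$. -}

module Defs where

open import Level using (0ℓ)
open import Data.Nat.Base as ℕ using (ℕ; zero; suc; pred)
open import Data.Nat.Divisibility using (_∣?_)
import Data.Nat.ListAction as ℕ
open import Data.Nat.GCD using (gcd)
open import Data.Nat.Primality using (prime?)
open import Data.Integer.Base as ℤ using (ℤ; 0ℤ; 1ℤ; ∣_∣)
import Data.Integer.Properties as ℤ
open import Data.Rational.Base as ℚ using (ℚ; 0ℚ; ↥_; ↧ₙ_)
open import Data.List.Base using (List; []; _∷_; map; length; filter; upTo)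
open import Data.List.Membership.Propositional using (_∈_)
open import Data.Product.Base using (∃-syntax)
open import Data.Sign.Base as Sign using (Sign)
open import Data.Sum.Base using (_⊎_)
open import Data.Vec.Functional using (Vector)
open import Function.Bundles using (_⇔_)
open import Relation.Binary.PropositionalEquality.Core using (_≡_)
open import Relation.Nullary.Decidable using (yes; no; _×-dec_)
open import Relation.Unary using (Pred)
open import Algebra.Bundles.Raw using (RawRing)
import Algebra.Definitions.RawSemiring as RawSemiringDefinitions

-- An integer polynomial is a list of coefficients, constant term first.
-- Trailing zeros are allowed, so equality of polynomials is _≈_, not _≡_.

Poly : Set
Poly = List ℤ

coeff : Poly → ℕ → ℤ
coeff []      _       = 0ℤ
coeff (a ∷ p) zero    = a
coeff (a ∷ p) (suc i) = coeff p i

infix 4 _≈_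

record _≈_ (p q : Poly) : Set where
  constructor mk≈
  field
    coeff-≡ : ∀ i → coeff p i ≡ coeff q i

open _≈_ public

infixl 6 _+ₚ_
infixl 7 _*ₚ_

_+ₚ_ : Poly → Poly → Poly
[]      +ₚ q       = q
(a ∷ p) +ₚ []      = a ∷ p
(a ∷ p) +ₚ (b ∷ q) = a ℤ.+ b ∷ p +ₚ q

-ₚ_ : Poly → Poly
-ₚ_ = map (ℤ.-_)

_*ₚ_ : Poly → Poly → Poly
[]      *ₚ q = []
(a ∷ p) *ₚ q = map (a ℤ.*_) q +ₚ (0ℤ ∷ p *ₚ q)

1ₚ : Poly
1ₚ = 1ℤ ∷ []

polyRawRing : RawRing 0ℓ 0ℓ
polyRawRing = record
  { Carrier = Poly
  ; _≈_     = _≈_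
  ; _+_     = _+ₚ_
  ; _*_     = _*ₚ_
  ; -_      = -ₚ_
  ; 0#      = []
  ; 1#      = 1ₚ
  }

open RawSemiringDefinitions (RawRing.rawSemiring polyRawRing) public
  using () renaming (_∣_ to _∣ₚ_; _^_ to _^ₚ_; product to ∏)

infixl 6 _±[_]_

_±[_]_ : Poly → Sign → Poly → Poly
p ±[ Sign.+ ] q = p +ₚ q
p ±[ Sign.- ] q = p +ₚ (-ₚ q)

∏^ : ∀ {n} → Vector Poly n → Vector ℕ n → Poly
∏^ fs es = ∏ (λ i → fs i ^ₚ es i)

eval : Poly → ℤ → ℤ
eval []      x = 0ℤ
eval (a ∷ p) x = a ℤ.+ x ℤ.* eval p x

trim : Poly → Poly
trim []      = []
trim (a ∷ p) with trim p
... | b ∷ q = a ∷ b ∷ q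
... | []    with a ℤ.≟ 0ℤ
...   | yes _ = []
...   | no  _ = a ∷ []

-- The zero polynomial gets degree 0 (instead of -∞) and leading
-- coefficient 0; positivity of a leading coefficient therefore excludes it.

deg : Poly → ℕ
deg p = pred (length (trim p))

leadingCoeff : Poly → ℤ
leadingCoeff p = coeff p (deg p)

NoCommonFactor : Poly → Poly → Set
NoCommonFactor p q = ∀ d → d ∣ₚ p → d ∣ₚ q → d ≈ 1ₚ ⊎ d ≈ -ₚ 1ₚ

Finite : {A : Set} → Pred A 0ℓ → Set
Finite P = ∃[ zs ] (∀ z → z ∈ zs ⇔ P z)

-- For a, b, c > 0 every divisor of a b c is at most a b c, so this is
-- the product of all primes dividing a b c, each taken once.

N : ℕ → ℕ → ℕ → ℕ
N a b c = ℕ.product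
  (filter (λ p → prime? p ×-dec p ∣? abc) (upTo (suc abc)))
  where
  abc : ℕ
  abc = a ℕ.* b ℕ.* c

-- With ε = p / q, the inequality c ≤ C N^(1+ε) is stated in its q-th power
-- c^q ≤ C^q N^(q+p).  Taking ε rational and C a natural number loses
-- nothing: N^(1+ε) increases with ε because N ≥ 1, and C can be rounded up.

ABC-Conjecture : Set
ABC-Conjecture =
  ∀ (ε : ℚ) → 0ℚ ℚ.< ε →
  ∃[ C ] (∀ (a b c : ℕ) → 0 ℕ.< a → 0 ℕ.< b → 0 ℕ.< c →
    gcd (gcd a b) c ≡ 1 → a ℕ.+ b ≡ c →
    c ℕ.^ ↧ₙ ε ℕ.≤ C ℕ.^ ↧ₙ ε ℕ.* N a b c ℕ.^ (↧ₙ ε ℕ.+ ∣ ↥ ε ∣))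

{-# OPTIONS --safe #-}
module Submission where

-- For a solution (x , y) with |x| large, |y| ≤ |x| because deg g > deg f.  As
-- F₁ = ∏ f₁ and F₂ = ∏ f₂ satisfy an identity u F₁ + v F₂ = ρ with ρ a nonzero
-- integer, the common divisors of the two terms of f(x) = g(y) divide a fixed
-- power of ρ.  After division by their gcd the ABC-Conjecture applies, and the
-- radical divides F₁(x) F₂(x) G(y), where G = ∏ gs.  With E = deg (F₁ F₂ G),
-- D = deg f ≥ E + 2 and ε = 1/D, this gives |x|^(D·D) ≪ |x|^(E·(D+1)), whose
-- exponents differ by at least 1; so |x| is bounded, and then so is |y|.
--
-- The identity comes from pseudo-division (Euclid's algorithm without
-- fractions): the primitive part of the resulting gcd divides F₁ and F₂ by
-- Gauss's lemma, hence is ±1.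

open import Defs
open import Level using (0ℓ)
open import Data.Nat.Base as ℕ using (ℕ; zero; suc; _<_; _≤_; _+_; _*_; _^_; z≤n; s≤s)
import Data.Nat.Coprimality as ℕ
import Data.Nat.Divisibility as ℕ
import Data.Nat.ListAction as ℕ
import Data.Nat.Properties as ℕ
import Data.Nat.Tactic.RingSolver as ℕ
open import Data.Nat.GCD using (gcd; gcd[m,n]∣m; gcd[m,n]∣n; gcd-greatest; gcd-zeroˡ; c*gcd[m,n]≡gcd[cm,cn])
open import Data.Nat.Primality using (Prime; prime?; euclidsLemma; prime⇒nonZero; ¬prime[1])
open import Data.Nat.Primality.Factorisation using (factorise; PrimeFactorisation; factorisationHasAllPrimeFactors)
open import Data.Integer.Base as ℤ using (ℤ; +_; 0ℤ; 1ℤ; ∣_∣)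
import Data.Integer.Properties as ℤ
open import Data.Integer.Divisibility.Signed as ℤ using (divides) renaming (_∣_ to _∣ₛ_)
open import Data.Integer.Tactic.RingSolver using (solve-∀)
open import Data.Rational.Base using (mkℚ)
open import Data.Rational.Properties using (positive⁻¹)
open import Data.Fin.Base using (zero; suc)
open import Data.List.Base using (List; []; _∷_; _++_; map; length; filter; upTo; cartesianProduct)
open import Data.List.Membership.Propositional using (_∈_)
open import Data.List.Membership.Propositional.Properties using (∈-map⁺; ∈-++⁺ˡ; ∈-++⁺ʳ; ∈-upTo⁺; ∈-filter⁺; ∈-filter⁻; ∈-cartesianProduct⁺)
open import Data.List.Relation.Unary.All as All using (All; []; _∷_)
open import Data.List.Relation.Unary.All.Properties using (all-filter)
open import Data.List.Relation.Unary.AllPairs using ([]; _∷_)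
open import Data.List.Relation.Unary.Unique.Propositional using (Unique)
open import Data.List.Relation.Unary.Unique.Propositional.Properties using (upTo⁺; filter⁺)
open import Data.Product.Base using (_×_; _,_; ∃-syntax; proj₁; proj₂)
open import Data.Sign.Base using (Sign)
open import Data.Sum.Base using (_⊎_; inj₁; inj₂; [_,_]′; map₁; map₂)
open import Data.Vec.Functional using (Vector)
open import Function.Base using (_∘_; id)
open import Function.Bundles using (mk⇔)
open import Relation.Binary.PropositionalEquality
open import Relation.Nullary.Decidable using (yes; no; _×-dec_)
open import Relation.Nullary.Negation using (¬_; contradiction)
open import Relation.Unary using (Pred; Decidable)

-- Evaluation and coefficients

eval-+ₚ : ∀ p q x → eval (p +ₚ q) x ≡ eval p x ℤ.+ eval q x
eval-+ₚ []      q       x = sym (ℤ.+-identityˡ _)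
eval-+ₚ (a ∷ p) []      x = sym (ℤ.+-identityʳ _)
eval-+ₚ (a ∷ p) (b ∷ q) x rewrite eval-+ₚ p q x = rearrange a b x (eval p x) (eval q x)
  where
  rearrange : ∀ a b x y z → a ℤ.+ b ℤ.+ x ℤ.* (y ℤ.+ z) ≡ a ℤ.+ x ℤ.* y ℤ.+ (b ℤ.+ x ℤ.* z)
  rearrange = solve-∀

eval-scale : ∀ c p x → eval (map (c ℤ.*_) p) x ≡ c ℤ.* eval p x
eval-scale c []      x = sym (ℤ.*-zeroʳ c)
eval-scale c (a ∷ p) x rewrite eval-scale c p x = rearrange a c x (eval p x)
  where
  rearrange : ∀ a c x y → c ℤ.* a ℤ.+ x ℤ.* (c ℤ.* y) ≡ c ℤ.* (a ℤ.+ x ℤ.* y)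
  rearrange = solve-∀

eval--ₚ : ∀ p x → eval (-ₚ p) x ≡ ℤ.- eval p x
eval--ₚ []      x = refl
eval--ₚ (a ∷ p) x rewrite eval--ₚ p x = rearrange a x (eval p x)
  where
  rearrange : ∀ a x y → ℤ.- a ℤ.+ x ℤ.* (ℤ.- y) ≡ ℤ.- (a ℤ.+ x ℤ.* y)
  rearrange = solve-∀

eval-*ₚ : ∀ p q x → eval (p *ₚ q) x ≡ eval p x ℤ.* eval q x
eval-*ₚ []      q x = refl
eval-*ₚ (a ∷ p) q x
  rewrite eval-+ₚ (map (a ℤ.*_) q) (0ℤ ∷ p *ₚ q) x | eval-scale a q x | eval-*ₚ p q x
  = rearrange a x (eval p x) (eval q x)
  where
  rearrange : ∀ a x y z → a ℤ.* z ℤ.+ (0ℤ ℤ.+ x ℤ.* (y ℤ.* z)) ≡ (a ℤ.+ x ℤ.* y) ℤ.* z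
  rearrange = solve-∀

eval-^ₚ : ∀ p k x → eval (p ^ₚ k) x ≡ eval p x ℤ.^ k
eval-^ₚ p zero    x = cong (λ z → 1ℤ ℤ.+ z) (ℤ.*-zeroʳ x)
eval-^ₚ p (suc k) x = trans (eval-*ₚ p (p ^ₚ k) x) (cong (eval p x ℤ.*_) (eval-^ₚ p k x))

eval-trim : ∀ p x → eval (trim p) x ≡ eval p x
eval-trim []      x = refl
eval-trim (a ∷ p) x with trim p | eval-trim p x
... | b ∷ q | ih = cong (λ z → a ℤ.+ x ℤ.* z) ih
... | []    | ih with a ℤ.≟ 0ℤ
...   | yes refl = sym (trans (ℤ.+-identityˡ _) (trans (cong (x ℤ.*_) (sym ih)) (ℤ.*-zeroʳ x)))
...   | no  _    = cong (λ z → a ℤ.+ x ℤ.* z) ih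

coeff-+ₚ : ∀ p q i → coeff (p +ₚ q) i ≡ coeff p i ℤ.+ coeff q i
coeff-+ₚ []      q       i       = sym (ℤ.+-identityˡ _)
coeff-+ₚ (a ∷ p) []      i       = sym (ℤ.+-identityʳ _)
coeff-+ₚ (a ∷ p) (b ∷ q) zero    = refl
coeff-+ₚ (a ∷ p) (b ∷ q) (suc i) = coeff-+ₚ p q i

coeff-scale : ∀ c p i → coeff (map (c ℤ.*_) p) i ≡ c ℤ.* coeff p i
coeff-scale c []      i       = sym (ℤ.*-zeroʳ c)
coeff-scale c (a ∷ p) zero    = refl
coeff-scale c (a ∷ p) (suc i) = coeff-scale c p i

coeff--ₚ : ∀ p i → coeff (-ₚ p) i ≡ ℤ.- coeff p i
coeff--ₚ []      i       = refl
coeff--ₚ (a ∷ p) zero    = refl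
coeff--ₚ (a ∷ p) (suc i) = coeff--ₚ p i

coeff-∷-*ₚ : ∀ a p q i → coeff ((a ∷ p) *ₚ q) i ≡ a ℤ.* coeff q i ℤ.+ coeff (0ℤ ∷ p *ₚ q) i
coeff-∷-*ₚ a p q i =
  trans (coeff-+ₚ (map (a ℤ.*_) q) _ i) (cong (ℤ._+ coeff (0ℤ ∷ p *ₚ q) i) (coeff-scale a q i))

-- Each coefficient is forced in turn: the constant term a is divisible by
-- every large x, hence zero, and x can then be cancelled.
eventually-zero⇒coeff≡0 : ∀ B p → (∀ x → B ≤ x → eval p (+ x) ≡ 0ℤ) → ∀ i → coeff p i ≡ 0ℤ
eventually-zero⇒coeff≡0 B []      p≡0 i = refl
eventually-zero⇒coeff≡0 B (a ∷ p) p≡0 = coeffs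
  where
  open ≡-Reasoning
  X = suc (B + ∣ a ∣)

  X∣a : ∣ + X ∣ ℕ.∣ ∣ a ∣
  X∣a = ℤ.∣⇒∣ᵤ (divides (ℤ.- eval p (+ X)) (begin
    a ≡⟨ isolate a (+ X) (eval p (+ X)) ⟩
    a ℤ.+ + X ℤ.* eval p (+ X) ℤ.+ ℤ.- eval p (+ X) ℤ.* + X
      ≡⟨ cong (ℤ._+ ℤ.- eval p (+ X) ℤ.* + X) (p≡0 X (ℕ.≤-trans (ℕ.m≤m+n B ∣ a ∣) (ℕ.n≤1+n _))) ⟩
    0ℤ ℤ.+ ℤ.- eval p (+ X) ℤ.* + X ≡⟨ ℤ.+-identityˡ _ ⟩
    ℤ.- eval p (+ X) ℤ.* + X ∎))
    where
    isolate : ∀ a x y → a ≡ a ℤ.+ x ℤ.* y ℤ.+ ℤ.- y ℤ.* x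
    isolate = solve-∀

  a≡0 : a ≡ 0ℤ
  a≡0 with ∣ a ∣ in eq | X∣a
  ... | zero  | _   = ℤ.∣i∣≡0⇒i≡0 eq
  ... | suc n | X∣ = contradiction (ℕ.∣⇒≤ X∣) (ℕ.<⇒≱ (s≤s (ℕ.m≤n+m (suc n) B)))

  -- The threshold rises by one so that x is nonzero and can be cancelled.
  tail≡0 : ∀ x → suc B ≤ x → eval p (+ x) ≡ 0ℤ
  tail≡0 (suc x) B<x = ℤ.*-cancelˡ-≡ (+ suc x) _ _ (begin
    + suc x ℤ.* eval p (+ suc x)         ≡⟨ ℤ.+-identityˡ _ ⟨
    0ℤ ℤ.+ + suc x ℤ.* eval p (+ suc x)  ≡⟨ cong (ℤ._+ + suc x ℤ.* eval p (+ suc x)) a≡0 ⟨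
    a ℤ.+ + suc x ℤ.* eval p (+ suc x)   ≡⟨ p≡0 (suc x) (ℕ.<⇒≤ B<x) ⟩
    0ℤ                                   ≡⟨ ℤ.*-zeroʳ (+ suc x) ⟨
    + suc x ℤ.* 0ℤ ∎)

  coeffs : ∀ i → coeff (a ∷ p) i ≡ 0ℤ
  coeffs zero    = a≡0
  coeffs (suc i) = eventually-zero⇒coeff≡0 (suc B) p tail≡0 i

-- The difference vanishes at every natural number, so all its coefficients are zero. Polynomial
-- identities can therefore be checked on values, as identities between integers.
pointwise⇒≈ : ∀ p q → (∀ x → eval p x ≡ eval q x) → p ≈ q
pointwise⇒≈ p q p≡q = mk≈ λ i → ℤ.i-j≡0⇒i≡j _ _ (begin
  coeff p i ℤ.+ ℤ.- coeff q i     ≡⟨ cong (λ z → coeff p i ℤ.+ z) (coeff--ₚ q i) ⟨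
  coeff p i ℤ.+ coeff (-ₚ q) i    ≡⟨ coeff-+ₚ p (-ₚ q) i ⟨
  coeff (p +ₚ -ₚ q) i             ≡⟨ eventually-zero⇒coeff≡0 0 (p +ₚ -ₚ q) diff≡0 i ⟩
  0ℤ ∎)
  where
  open ≡-Reasoning
  diff≡0 : ∀ x → 0 ≤ x → eval (p +ₚ -ₚ q) (+ x) ≡ 0ℤ
  diff≡0 x _ rewrite eval-+ₚ p (-ₚ q) (+ x) | eval--ₚ q (+ x) | p≡q (+ x) = ℤ.+-inverseʳ (eval q (+ x))

coeff≡0⇒eval≡0 : ∀ p → (∀ i → coeff p i ≡ 0ℤ) → ∀ x → eval p x ≡ 0ℤ
coeff≡0⇒eval≡0 []      p≈[] x = refl
coeff≡0⇒eval≡0 (a ∷ p) p≈[] x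
  rewrite p≈[] 0 | coeff≡0⇒eval≡0 p (p≈[] ∘ suc) x = trans (ℤ.+-identityˡ _) (ℤ.*-zeroʳ x)

≈⇒pointwise : ∀ {p q} → p ≈ q → ∀ x → eval p x ≡ eval q x
≈⇒pointwise {[]}    {q}     p≈q x = sym (coeff≡0⇒eval≡0 q (sym ∘ coeff-≡ p≈q) x)
≈⇒pointwise {a ∷ p} {[]}    p≈q x = coeff≡0⇒eval≡0 (a ∷ p) (coeff-≡ p≈q) x
≈⇒pointwise {a ∷ p} {b ∷ q} p≈q x =
  cong₂ (λ c y → c ℤ.+ x ℤ.* y) (coeff-≡ p≈q 0) (≈⇒pointwise {p} {q} (mk≈ (coeff-≡ p≈q ∘ suc)) x)

-- Growth

-- An inductive form of trimmed nonzero polynomials, so that growth can be proved by recursion along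
-- Horner's scheme.
data Normal : Poly → ℕ → Set where
  [_≢0] : ∀ {a} → a ≢ 0ℤ → Normal (a ∷ []) 0
  _∷_   : ∀ {p d} a → Normal p d → Normal (a ∷ p) (suc d)

trim-normal : ∀ p → trim p ≡ [] ⊎ Normal (trim p) (deg p)
trim-normal []      = inj₁ refl
trim-normal (a ∷ p) with trim p | trim-normal p
... | b ∷ q | inj₂ normal = inj₂ (a ∷ normal)
... | []    | _ with a ℤ.≟ 0ℤ
...   | yes _   = inj₁ refl
...   | no  a≢0 = inj₂ [ a≢0 ≢0]

NonZeroₚ : Poly → Set
NonZeroₚ p = Normal (trim p) (deg p)

leadingCoeff>0⇒nonZero : ∀ p → 0ℤ ℤ.< leadingCoeff p → NonZeroₚ p
leadingCoeff>0⇒nonZero p lc>0 with trim-normal p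
... | inj₂ normal = normal
... | inj₁ trim≡[] = contradiction (sym (coeff-≡ p≈[] (deg p))) (ℤ.<⇒≢ lc>0)
  where
  p≈[] : p ≈ []
  p≈[] = pointwise⇒≈ p [] λ x → trans (sym (eval-trim p x)) (cong (λ q → eval q x) trim≡[])

deg>0⇒nonZero : ∀ p → 0 < deg p → NonZeroₚ p
deg>0⇒nonZero p deg>0 with trim-normal p
... | inj₂ normal = normal
... | inj₁ trim≡[] = contradiction (cong (ℕ.pred ∘ length) trim≡[]) (ℕ.>⇒≢ deg>0)

-- In a + x v the integer v is nonzero by the inductive bound, so that |x v| ≥ |x| ≥ 2|a|. The
-- constant term then costs at most a factor 2.
normal-lower-bound : ∀ {p d} → Normal p d →
  ∃[ K ] ∃[ B ] (∀ x → B ≤ ∣ x ∣ → ∣ x ∣ ^ d ≤ K * ∣ eval p x ∣)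
normal-lower-bound ([_≢0] {a} a≢0) = 1 , 0 , bound
  where
  bound : ∀ x → 0 ≤ ∣ x ∣ → 1 ≤ 1 * ∣ a ℤ.+ x ℤ.* 0ℤ ∣
  bound x _ rewrite ℤ.*-zeroʳ x | ℤ.+-identityʳ a | ℕ.+-identityʳ ∣ a ∣ =
    ℕ.n≢0⇒n>0 (a≢0 ∘ ℤ.∣i∣≡0⇒i≡0)
normal-lower-bound {a ∷ p} {suc d} (a ∷ normal) with normal-lower-bound normal
-- The summand 2|a| lets x v dominate a, and `suc` makes |x| positive.
... | K , B , bound = K * 2 , suc (B + 2 * ∣ a ∣) , bound′
  where
  open ℕ.≤-Reasoning
  bound′ : ∀ x → suc (B + 2 * ∣ a ∣) ≤ ∣ x ∣ → ∣ x ∣ ^ suc d ≤ K * 2 * ∣ a ℤ.+ x ℤ.* eval p x ∣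
  bound′ x big = begin
    X * X ^ d         ≤⟨ ℕ.*-monoʳ-≤ X X^d≤Kv ⟩
    X * (K * v)       ≡⟨ swap X K v ⟩
    K * (X * v)       ≤⟨ ℕ.*-monoʳ-≤ K Xv≤2w ⟩
    K * (2 * w)       ≡⟨ ℕ.*-assoc K 2 w ⟨
    K * 2 * w ∎
    where
    X = ∣ x ∣
    v = ∣ eval p x ∣
    w = ∣ a ℤ.+ x ℤ.* eval p x ∣

    swap : ∀ a b c → a * (b * c) ≡ b * (a * c)
    swap = ℕ.solve-∀

    X^d≤Kv : X ^ d ≤ K * v
    X^d≤Kv = bound x (ℕ.≤-trans (ℕ.m≤m+n B _) (ℕ.<⇒≤ big))

    1≤X : 1 ≤ X
    1≤X = ℕ.≤-trans (s≤s z≤n) big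

    0<v : 0 < v
    0<v = ℕ.n≢0⇒n>0 λ v≡0 → ℕ.<⇒≱ (ℕ.m^n>0 X {{ℕ.>-nonZero 1≤X}} d)
      (ℕ.≤-trans X^d≤Kv (ℕ.≤-reflexive (trans (cong (K *_) v≡0) (ℕ.*-zeroʳ K))))

    isolate : ∀ a y → y ≡ (a ℤ.+ y) ℤ.- a
    isolate = solve-∀

    Xv≤w+∣a∣ : X * v ≤ w + ∣ a ∣
    Xv≤w+∣a∣ = begin
      X * v                                   ≡⟨ ℤ.abs-* x (eval p x) ⟨
      ∣ x ℤ.* eval p x ∣                      ≡⟨ cong ∣_∣ (isolate a (x ℤ.* eval p x)) ⟩
      ∣ (a ℤ.+ x ℤ.* eval p x) ℤ.- a ∣        ≤⟨ ℤ.∣i-j∣≤∣i∣+∣j∣ (a ℤ.+ x ℤ.* eval p x) a ⟩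
      w + ∣ a ∣ ∎

    2∣a∣≤Xv : 2 * ∣ a ∣ ≤ X * v
    2∣a∣≤Xv = begin
      2 * ∣ a ∣  ≤⟨ ℕ.≤-trans (ℕ.m≤n+m _ B) (ℕ.<⇒≤ big) ⟩
      X          ≤⟨ ℕ.m≤m*n X v {{ℕ.>-nonZero 0<v}} ⟩
      X * v ∎

    double : ∀ m → m + m ≡ 2 * m
    double = ℕ.solve-∀

    -- Adding X v to both sides avoids truncated subtraction: 2 X v ≤ 2 w + 2|a| ≤ 2 w + X v.
    Xv≤2w : X * v ≤ 2 * w
    Xv≤2w = ℕ.+-cancelʳ-≤ (X * v) (X * v) (2 * w) (begin
      X * v + X * v          ≡⟨ double (X * v) ⟩
      2 * (X * v)            ≤⟨ ℕ.*-monoʳ-≤ 2 Xv≤w+∣a∣ ⟩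
      2 * (w + ∣ a ∣)        ≡⟨ ℕ.*-distribˡ-+ 2 w ∣ a ∣ ⟩
      2 * w + 2 * ∣ a ∣      ≤⟨ ℕ.+-monoʳ-≤ (2 * w) 2∣a∣≤Xv ⟩
      2 * w + X * v ∎)

lower-bound : ∀ p → NonZeroₚ p →
  ∃[ K ] ∃[ B ] (∀ x → B ≤ ∣ x ∣ → ∣ x ∣ ^ deg p ≤ K * ∣ eval p x ∣)
lower-bound p nonZero with normal-lower-bound nonZero
... | K , B , bound = K , B , λ x B≤ →
  subst (λ z → ∣ x ∣ ^ deg p ≤ K * ∣ z ∣) (eval-trim p x) (bound x B≤)

-- X is kept apart from |x| because values at x are later compared with powers of |y|, and values at
-- y with powers of |x|.
length-upper-bound : ∀ p →
  ∃[ K ] (∀ X x → 0 < X → ∣ x ∣ ≤ X → ∣ eval p x ∣ ≤ K * X ^ ℕ.pred (length p))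
length-upper-bound []          = 0 , λ _ _ _ _ → z≤n
length-upper-bound (a ∷ [])    = ∣ a ∣ , bound
  where
  bound : ∀ X x → 0 < X → ∣ x ∣ ≤ X → ∣ a ℤ.+ x ℤ.* 0ℤ ∣ ≤ ∣ a ∣ * 1
  bound X x _ _ rewrite ℤ.*-zeroʳ x | ℤ.+-identityʳ a = ℕ.≤-reflexive (sym (ℕ.*-identityʳ ∣ a ∣))
length-upper-bound (a ∷ p@(b ∷ q)) with length-upper-bound p
... | K , bound = ∣ a ∣ + K , bound′
  where
  open ℕ.≤-Reasoning
  d = length q
  bound′ : ∀ X x → 0 < X → ∣ x ∣ ≤ X → ∣ a ℤ.+ x ℤ.* eval p x ∣ ≤ (∣ a ∣ + K) * X ^ suc d
  bound′ X x 0<X ∣x∣≤X = begin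
    ∣ a ℤ.+ x ℤ.* eval p x ∣            ≤⟨ ℤ.∣i+j∣≤∣i∣+∣j∣ a (x ℤ.* eval p x) ⟩
    ∣ a ∣ + ∣ x ℤ.* eval p x ∣          ≡⟨ cong (λ z → ∣ a ∣ + z) (ℤ.abs-* x (eval p x)) ⟩
    ∣ a ∣ + ∣ x ∣ * ∣ eval p x ∣        ≤⟨ ℕ.+-mono-≤ (ℕ.m≤m*n ∣ a ∣ (X ^ suc d))
                                             (ℕ.*-mono-≤ ∣x∣≤X (bound X x 0<X ∣x∣≤X)) ⟩
    ∣ a ∣ * X ^ suc d + X * (K * X ^ d) ≡⟨ collect ∣ a ∣ X K (X ^ d) ⟩
    (∣ a ∣ + K) * X ^ suc d ∎
    where
    instance
      X^-nonZero : ℕ.NonZero (X ^ suc d)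
      X^-nonZero = ℕ.m^n≢0 X (suc d) {{ℕ.>-nonZero 0<X}}
    collect : ∀ a x k y → a * (x * y) + x * (k * y) ≡ (a + k) * (x * y)
    collect = ℕ.solve-∀

upper-bound : ∀ p → ∃[ K ] (∀ X x → 0 < X → ∣ x ∣ ≤ X → ∣ eval p x ∣ ≤ K * X ^ deg p)
upper-bound p with length-upper-bound (trim p)
... | K , bound = K , λ X x 0<X ∣x∣≤X →
  subst (λ z → ∣ z ∣ ≤ K * X ^ deg p) (eval-trim p x) (bound X x 0<X ∣x∣≤X)

-- Bézout's identity for polynomials without common factor

-- A gcd over the rationals expressed in integer polynomials: h is a combination of p and q, and
-- divides both after multiplication by the nonzero integer s.
record PseudoGcd (p q : Poly) : Set where
  field
    h u v k l : Poly
    s         : ℤ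
    s≢0       : s ≢ 0ℤ
    combination : ∀ x → eval h x ≡ eval u x ℤ.* eval p x ℤ.+ eval v x ℤ.* eval q x
    h∣sp        : ∀ x → s ℤ.* eval p x ≡ eval k x ℤ.* eval h x
    h∣sq        : ∀ x → s ℤ.* eval q x ≡ eval l x ℤ.* eval h x

pseudoGcd-swap : ∀ {p q} → PseudoGcd p q → PseudoGcd q p
pseudoGcd-swap {p} {q} d = record
  { h = h ; u = v ; v = u ; k = l ; l = k ; s = s ; s≢0 = s≢0
  ; combination = λ x → trans (combination x) (ℤ.+-comm (eval u x ℤ.* eval p x) _)
  ; h∣sp = h∣sq ; h∣sq = h∣sp }
  where open PseudoGcd d

pseudoGcd-zeroˡ : ∀ p q → (∀ x → eval p x ≡ 0ℤ) → PseudoGcd p q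
pseudoGcd-zeroˡ p q p≡0 = record
  { h = q ; u = [] ; v = 1ₚ ; k = [] ; l = 1ₚ ; s = 1ℤ ; s≢0 = λ ()
  ; combination = λ x → lemma x (eval p x) (eval q x)
  ; h∣sp = λ x → cong (1ℤ ℤ.*_) (p≡0 x)
  ; h∣sq = λ x → lemma′ x (eval q x) }
  where
  lemma : ∀ x y z → z ≡ 0ℤ ℤ.* y ℤ.+ (1ℤ ℤ.+ x ℤ.* 0ℤ) ℤ.* z
  lemma = solve-∀
  lemma′ : ∀ x z → 1ℤ ℤ.* z ≡ (1ℤ ℤ.+ x ℤ.* 0ℤ) ℤ.* z
  lemma′ = solve-∀

-- One step of pseudo-division, undone: the same h serves for p and q. The scalar s gains the factor
-- b, since s b p = s (b p + t q) - t (s q), which is (k - t l) h.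
pseudoGcd-reduce : ∀ p q t b → b ≢ 0ℤ → PseudoGcd (map (b ℤ.*_) p +ₚ t *ₚ q) q → PseudoGcd p q
pseudoGcd-reduce p q t b b≢0 d = record
  { h = h ; u = map (b ℤ.*_) u ; v = u *ₚ t +ₚ v
  ; k = k +ₚ -ₚ (t *ₚ l) ; l = map (b ℤ.*_) l ; s = s ℤ.* b
  ; s≢0 = λ sb≡0 → [ s≢0 , b≢0 ]′ (ℤ.i*j≡0⇒i≡0∨j≡0 s sb≡0)
  ; combination = combination′ ; h∣sp = h∣sp′ ; h∣sq = h∣sq′ }
  where
  open PseudoGcd d
  open ≡-Reasoning

  eval-reduced : ∀ x → eval (map (b ℤ.*_) p +ₚ t *ₚ q) x ≡ b ℤ.* eval p x ℤ.+ eval t x ℤ.* eval q x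
  eval-reduced x rewrite eval-+ₚ (map (b ℤ.*_) p) (t *ₚ q) x | eval-scale b p x | eval-*ₚ t q x = refl

  combination′ : ∀ x → eval h x ≡
    eval (map (b ℤ.*_) u) x ℤ.* eval p x ℤ.+ eval (u *ₚ t +ₚ v) x ℤ.* eval q x
  combination′ x
    rewrite combination x | eval-reduced x | eval-scale b u x | eval-+ₚ (u *ₚ t) v x | eval-*ₚ u t x
    = regroup b (eval p x) (eval q x) (eval t x) (eval u x) (eval v x)
    where
    regroup : ∀ b p q t u v →
      u ℤ.* (b ℤ.* p ℤ.+ t ℤ.* q) ℤ.+ v ℤ.* q ≡ b ℤ.* u ℤ.* p ℤ.+ (u ℤ.* t ℤ.+ v) ℤ.* q
    regroup = solve-∀

  h∣sp′ : ∀ x → s ℤ.* b ℤ.* eval p x ≡ eval (k +ₚ -ₚ (t *ₚ l)) x ℤ.* eval h x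
  h∣sp′ x = begin
    s ℤ.* b ℤ.* P
      ≡⟨ expand s b P T Q ⟩
    s ℤ.* (b ℤ.* P ℤ.+ T ℤ.* Q) ℤ.- T ℤ.* (s ℤ.* Q)
      ≡⟨ cong₂ (λ y z → y ℤ.- T ℤ.* z) (trans (cong (s ℤ.*_) (sym (eval-reduced x))) (h∣sp x)) (h∣sq x) ⟩
    eval k x ℤ.* H ℤ.- T ℤ.* (eval l x ℤ.* H)
      ≡⟨ factor (eval k x) H T (eval l x) ⟩
    (eval k x ℤ.- T ℤ.* eval l x) ℤ.* H
      ≡⟨ cong (λ y → (eval k x ℤ.- y) ℤ.* H) (eval-*ₚ t l x) ⟨
    (eval k x ℤ.- eval (t *ₚ l) x) ℤ.* H
      ≡⟨ cong (λ y → (eval k x ℤ.+ y) ℤ.* H) (eval--ₚ (t *ₚ l) x) ⟨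
    (eval k x ℤ.+ eval (-ₚ (t *ₚ l)) x) ℤ.* H
      ≡⟨ cong (ℤ._* H) (eval-+ₚ k (-ₚ (t *ₚ l)) x) ⟨
    eval (k +ₚ -ₚ (t *ₚ l)) x ℤ.* H ∎
    where
    P = eval p x
    Q = eval q x
    T = eval t x
    H = eval h x
    expand : ∀ s b p t q → s ℤ.* b ℤ.* p ≡ s ℤ.* (b ℤ.* p ℤ.+ t ℤ.* q) ℤ.- t ℤ.* (s ℤ.* q)
    expand = solve-∀
    factor : ∀ k h t l → k ℤ.* h ℤ.- t ℤ.* (l ℤ.* h) ≡ (k ℤ.- t ℤ.* l) ℤ.* h
    factor = solve-∀

  h∣sq′ : ∀ x → s ℤ.* b ℤ.* eval q x ≡ eval (map (b ℤ.*_) l) x ℤ.* eval h x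
  h∣sq′ x = begin
    s ℤ.* b ℤ.* eval q x                         ≡⟨ swap s b (eval q x) ⟩
    b ℤ.* (s ℤ.* eval q x)                       ≡⟨ cong (b ℤ.*_) (h∣sq x) ⟩
    b ℤ.* (eval l x ℤ.* eval h x)                ≡⟨ ℤ.*-assoc b (eval l x) (eval h x) ⟨
    b ℤ.* eval l x ℤ.* eval h x                  ≡⟨ cong (ℤ._* eval h x) (eval-scale b l x) ⟨
    eval (map (b ℤ.*_) l) x ℤ.* eval h x ∎
    where
    swap : ∀ s b q → s ℤ.* b ℤ.* q ≡ b ℤ.* (s ℤ.* q)
    swap = solve-∀

-- Euclid's algorithm by pseudo-division

VanishesFrom : ℕ → Poly → Set
VanishesFrom n p = ∀ i → n ≤ i → coeff p i ≡ 0ℤ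

vanishesFrom-length : ∀ p → VanishesFrom (length p) p
vanishesFrom-length []      i       _         = refl
vanishesFrom-length (a ∷ p) (suc i) (s≤s n≤i) = vanishesFrom-length p i n≤i

vanishesFrom-pred : ∀ {n p} → VanishesFrom (suc n) p → coeff p n ≡ 0ℤ → VanishesFrom n p
vanishesFrom-pred vanishes pₙ≡0 i n≤i with ℕ.m≤n⇒m<n∨m≡n n≤i
... | inj₁ n<i  = vanishes i n<i
... | inj₂ refl = pₙ≡0

monomial : ℕ → ℤ → Poly
monomial zero    a = a ∷ []
monomial (suc k) a = 0ℤ ∷ monomial k a

coeff-monomial-*ₚ : ∀ k a q i → coeff (monomial k a *ₚ q) (k + i) ≡ a ℤ.* coeff q i
coeff-monomial-*ₚ zero    a q i =
  trans (coeff-∷-*ₚ a [] q i) (trans (cong (λ z → a ℤ.* coeff q i ℤ.+ z) (zeros i)) (ℤ.+-identityʳ _))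
  where
  zeros : ∀ i → coeff (0ℤ ∷ []) i ≡ 0ℤ
  zeros zero    = refl
  zeros (suc i) = refl
coeff-monomial-*ₚ (suc k) a q i =
  trans (coeff-∷-*ₚ 0ℤ (monomial k a) q (suc k + i))
    (trans (ℤ.+-identityˡ (coeff (monomial k a *ₚ q) (k + i))) (coeff-monomial-*ₚ k a q i))

-- Take t = -a x^(m - n), where a is the coefficient of p at m and b that of q at n: at index m the
-- reduced polynomial has b a - a b = 0.
leading-term-cancels : ∀ {m n} p q → n ≤ m → VanishesFrom (suc m) p → VanishesFrom (suc n) q →
  ∃[ t ] VanishesFrom m (map (coeff q n ℤ.*_) p +ₚ t *ₚ q)
leading-term-cancels {m} {n} p q n≤m p-vanishes q-vanishes with ℕ.m≤n⇒∃[o]m+o≡n n≤m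
... | k , refl = monomial k (ℤ.- a) , vanishes
  where
  a = coeff p (n + k)
  b = coeff q n

  coeff-reduced : ∀ j → coeff (map (b ℤ.*_) p +ₚ monomial k (ℤ.- a) *ₚ q) (k + j) ≡
                        b ℤ.* coeff p (k + j) ℤ.+ ℤ.- a ℤ.* coeff q j
  coeff-reduced j
    rewrite coeff-+ₚ (map (b ℤ.*_) p) (monomial k (ℤ.- a) *ₚ q) (k + j)
          | coeff-scale b p (k + j) | coeff-monomial-*ₚ k (ℤ.- a) q j = refl

  cancels : ∀ j → n ≤ j → b ℤ.* coeff p (k + j) ℤ.+ ℤ.- a ℤ.* coeff q j ≡ 0ℤ
  cancels j n≤j with ℕ.m≤n⇒m<n∨m≡n n≤j
  ... | inj₁ n<j
    rewrite p-vanishes (k + j) (subst (_≤ k + j) (trans (ℕ.+-suc k n) (cong suc (ℕ.+-comm k n)))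
                                 (ℕ.+-monoʳ-≤ k n<j))
          | q-vanishes j n<j = cong₂ ℤ._+_ (ℤ.*-zeroʳ b) (ℤ.*-zeroʳ (ℤ.- a))
  ... | inj₂ refl rewrite ℕ.+-comm k n = cross b a
    where
    cross : ∀ b a → b ℤ.* a ℤ.+ ℤ.- a ℤ.* b ≡ 0ℤ
    cross = solve-∀

  vanishes : VanishesFrom (n + k) (map (b ℤ.*_) p +ₚ monomial k (ℤ.- a) *ₚ q)
  -- Such an i is k + j with j ≥ n, the form in which the coefficients of x^k q are known.
  vanishes i n+k≤i with ℕ.m≤n⇒∃[o]m+o≡n (ℕ.≤-trans (ℕ.m≤n+m k n) n+k≤i)
  ... | j , refl = trans (coeff-reduced j)
    (cancels j (ℕ.+-cancelˡ-≤ k n j (subst (_≤ k + j) (ℕ.+-comm n k) n+k≤i)))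

-- The measure is the pair of degree bounds m and n, which allow for trailing zeros and for the zero
-- polynomial. A vanishing top coefficient lowers its bound directly; otherwise the polynomial with
-- the larger bound is reduced by the other.
pseudoGcd-vanishing : ∀ m n p q → VanishesFrom m p → VanishesFrom n q → PseudoGcd p q
pseudoGcd-vanishing zero    n       p q p-vanishes q-vanishes =
  pseudoGcd-zeroˡ p q (coeff≡0⇒eval≡0 p λ i → p-vanishes i z≤n)
pseudoGcd-vanishing (suc m) zero    p q p-vanishes q-vanishes =
  pseudoGcd-swap (pseudoGcd-zeroˡ q p (coeff≡0⇒eval≡0 q λ i → q-vanishes i z≤n))
pseudoGcd-vanishing (suc m) (suc n) p q p-vanishes q-vanishes
  with coeff p m ℤ.≟ 0ℤ | coeff q n ℤ.≟ 0ℤ | ℕ.≤-total n m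
... | yes a≡0 | _ | _ =
  pseudoGcd-vanishing m (suc n) p q (vanishesFrom-pred {p = p} p-vanishes a≡0) q-vanishes
... | no _ | yes b≡0 | _ =
  pseudoGcd-vanishing (suc m) n p q p-vanishes (vanishesFrom-pred {p = q} q-vanishes b≡0)
... | no _ | no b≢0 | inj₁ n≤m =
  let t , vanishes = leading-term-cancels p q n≤m p-vanishes q-vanishes
  in pseudoGcd-reduce p q t (coeff q n) b≢0 (pseudoGcd-vanishing m (suc n) _ q vanishes q-vanishes)
-- `pseudoGcd-reduce` acts on its first argument, so the pair is swapped around it to reduce q by p.
... | no a≢0 | no _ | inj₂ m≤n =
  let t , vanishes = leading-term-cancels q p m≤n q-vanishes p-vanishes
  in pseudoGcd-swap (pseudoGcd-reduce q p t (coeff p m) a≢0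
       (pseudoGcd-swap (pseudoGcd-vanishing (suc m) n p _ p-vanishes vanishes)))

pseudoGcd : ∀ p q → PseudoGcd p q
pseudoGcd p q = pseudoGcd-vanishing _ _ p q (vanishesFrom-length p) (vanishesFrom-length q)

-- Gauss's lemma and primitive parts

infix 4 _∣ᶜ_

_∣ᶜ_ : ℤ → Poly → Set
a ∣ᶜ p = ∀ i → a ∣ₛ coeff p i

∣ᶜ-∷ : ∀ {a b p} → a ∣ₛ b → a ∣ᶜ p → a ∣ᶜ b ∷ p
∣ᶜ-∷ a∣b a∣p zero    = a∣b
∣ᶜ-∷ a∣b a∣p (suc i) = a∣p i

∣ᶜ-resp-≈ : ∀ {a p q} → p ≈ q → a ∣ᶜ p → a ∣ᶜ q
∣ᶜ-resp-≈ p≈q a∣p i = subst (_ ∣ₛ_) (coeff-≡ p≈q i) (a∣p i)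

∣ᶜ-divide : ∀ a p → a ∣ᶜ p → ∃[ q ] (∀ x → eval p x ≡ a ℤ.* eval q x)
∣ᶜ-divide a []      a∣p = [] , λ x → sym (ℤ.*-zeroʳ a)
∣ᶜ-divide a (b ∷ p) a∣p with a∣p 0 | ∣ᶜ-divide a p (a∣p ∘ suc)
... | divides c refl | q , p≡aq = c ∷ q , λ x →
  trans (cong (λ y → c ℤ.* a ℤ.+ x ℤ.* y) (p≡aq x)) (factor c a x (eval q x))
  where
  factor : ∀ c a x y → c ℤ.* a ℤ.+ x ℤ.* (a ℤ.* y) ≡ a ℤ.* (c ℤ.+ x ℤ.* y)
  factor = solve-∀

*ₚ-comm : ∀ p q → p *ₚ q ≈ q *ₚ p
*ₚ-comm p q = pointwise⇒≈ _ _ λ x →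
  trans (eval-*ₚ p q x) (trans (ℤ.*-comm (eval p x) (eval q x)) (sym (eval-*ₚ q p x)))

-- The product is a q + x p q. As d divides a q, it divides x p q, whose coefficients are those of p
-- q shifted by one.
∣ᶜ-∷-*ₚ : ∀ {d a} p q → d ∣ₛ a → d ∣ᶜ (a ∷ p) *ₚ q → d ∣ᶜ p *ₚ q
∣ᶜ-∷-*ₚ {d} {a} p q d∣a d∣pq i =
  ℤ.∣m+n∣m⇒∣n (subst (d ∣ₛ_) (coeff-∷-*ₚ a p q (suc i)) (d∣pq (suc i))) (ℤ.∣m⇒∣m*n _ d∣a)

prime-∣* : ∀ {π} a b → Prime π → + π ∣ₛ a ℤ.* b → + π ∣ₛ a ⊎ + π ∣ₛ b
prime-∣* {π} a b π-prime π∣ab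
  with euclidsLemma ∣ a ∣ ∣ b ∣ π-prime (subst (π ℕ.∣_) (ℤ.abs-* a b) (ℤ.∣⇒∣ᵤ π∣ab))
... | inj₁ π∣a = inj₁ (ℤ.∣ᵤ⇒∣ π∣a)
... | inj₂ π∣b = inj₂ (ℤ.∣ᵤ⇒∣ π∣b)

gauss : ∀ {π} p q → Prime π → + π ∣ᶜ p *ₚ q → + π ∣ᶜ p ⊎ + π ∣ᶜ q
gauss []      q       π-prime π∣pq = inj₁ π∣pq
gauss (a ∷ p) []      π-prime π∣pq = inj₂ λ _ → divides 0ℤ refl
gauss {π} (a ∷ p) (b ∷ q) π-prime π∣pq =
  [ (λ π∣a → map₁ (∣ᶜ-∷ π∣a) (gauss p (b ∷ q) π-prime (∣ᶜ-∷-*ₚ p (b ∷ q) π∣a π∣pq)))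
  , (λ π∣b → map₂ (∣ᶜ-∷ π∣b) (gauss (a ∷ p) q π-prime
      (∣ᶜ-resp-≈ (*ₚ-comm q (a ∷ p))
        (∣ᶜ-∷-*ₚ q (a ∷ p) π∣b (∣ᶜ-resp-≈ (*ₚ-comm (a ∷ p) (b ∷ q)) π∣pq)))))
  ]′ (prime-∣* a b π-prime (subst (+ π ∣ₛ_) (ℤ.+-identityʳ _) (π∣pq 0)))

Primitive : Poly → Set
Primitive h = ∀ {π} → Prime π → ¬ (+ π ∣ᶜ h)

-- The primes are cancelled one at a time: by Gauss's lemma π divides k or h, and since h is
-- primitive it divides k.
primitive-∣-primes : ∀ h → Primitive h → ∀ πs → All Prime πs → ∀ f k →
  (∀ x → + ℕ.product πs ℤ.* eval f x ≡ eval k x ℤ.* eval h x) →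
  ∃[ k ] (∀ x → eval f x ≡ eval k x ℤ.* eval h x)
primitive-∣-primes h h-primitive []       _ f k eq =
  k , λ x → trans (sym (ℤ.*-identityˡ (eval f x))) (eq x)
primitive-∣-primes h h-primitive (π ∷ πs) (π-prime ∷ primes) f k eq
  with gauss k h π-prime (∣ᶜ-resp-≈ (pointwise⇒≈ (map (+ π ℤ.*_) (map (+ Π ℤ.*_) f)) (k *ₚ h) scaled) π∣)
  where
  Π = ℕ.product πs
  scaled : ∀ x → eval (map (+ π ℤ.*_) (map (+ Π ℤ.*_) f)) x ≡ eval (k *ₚ h) x
  scaled x = begin
    eval (map (+ π ℤ.*_) (map (+ Π ℤ.*_) f)) x ≡⟨ eval-scale (+ π) (map (+ Π ℤ.*_) f) x ⟩
    + π ℤ.* eval (map (+ Π ℤ.*_) f) x          ≡⟨ cong (+ π ℤ.*_) (eval-scale (+ Π) f x) ⟩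
    + π ℤ.* (+ Π ℤ.* eval f x)                 ≡⟨ ℤ.*-assoc (+ π) (+ Π) (eval f x) ⟨
    + π ℤ.* + Π ℤ.* eval f x                   ≡⟨ cong (ℤ._* eval f x) (ℤ.pos-* π Π) ⟨
    + (π * Π) ℤ.* eval f x                     ≡⟨ eq x ⟩
    eval k x ℤ.* eval h x                      ≡⟨ eval-*ₚ k h x ⟨
    eval (k *ₚ h) x ∎
    where open ≡-Reasoning
  π∣ : + π ∣ᶜ map (+ π ℤ.*_) (map (+ Π ℤ.*_) f)
  π∣ i = subst (+ π ∣ₛ_) (sym (coeff-scale (+ π) (map (+ Π ℤ.*_) f) i)) (ℤ.∣m⇒∣m*n _ ℤ.∣-refl)
... | inj₂ π∣h = contradiction π∣h (h-primitive π-prime)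
... | inj₁ π∣k = let k′ , k≡πk′ = ∣ᶜ-divide (+ π) k π∣k in
  primitive-∣-primes h h-primitive πs primes f k′ λ x → ℤ.*-cancelˡ-≡ (+ π) _ _ {{prime⇒nonZero π-prime}}
    (begin
      + π ℤ.* (+ ℕ.product πs ℤ.* eval f x)  ≡⟨ ℤ.*-assoc (+ π) (+ ℕ.product πs) (eval f x) ⟨
      + π ℤ.* + ℕ.product πs ℤ.* eval f x    ≡⟨ cong (ℤ._* eval f x) (ℤ.pos-* π (ℕ.product πs)) ⟨
      + (π * ℕ.product πs) ℤ.* eval f x      ≡⟨ eq x ⟩
      eval k x ℤ.* eval h x                  ≡⟨ cong (ℤ._* eval h x) (k≡πk′ x) ⟩
      + π ℤ.* eval k′ x ℤ.* eval h x         ≡⟨ ℤ.*-assoc (+ π) (eval k′ x) (eval h x) ⟩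
      + π ℤ.* (eval k′ x ℤ.* eval h x) ∎)
  where open ≡-Reasoning

+∣i∣≡sign◃1*i : ∀ i → + ∣ i ∣ ≡ (ℤ.sign i ℤ.◃ 1) ℤ.* i
+∣i∣≡sign◃1*i (+ n)        = sym (ℤ.*-identityˡ (+ n))
+∣i∣≡sign◃1*i (ℤ.-[1+ n ]) = cong (λ m → + suc m) (sym (ℕ.+-identityʳ n))

-- For a primitive h, divisibility over the rationals implies divisibility over the integers. The
-- sign of s moves into the quotient, which leaves |s|, a product of primes to cancel.
primitive-∣ : ∀ h → Primitive h → ∀ s → s ≢ 0ℤ → ∀ f k →
  (∀ x → s ℤ.* eval f x ≡ eval k x ℤ.* eval h x) →
  h ∣ₚ f
primitive-∣ h h-primitive s s≢0 f k eq =
  let k″ , f≡k″h = primitive-∣-primes h h-primitive factors factorsPrime f k′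
                     (subst (λ n → ∀ x → + n ℤ.* eval f x ≡ eval k′ x ℤ.* eval h x) isFactorisation eq′)
  in record { quotient = k″ ; equality = pointwise⇒≈ _ _ λ x → trans (eval-*ₚ k″ h x) (sym (f≡k″h x)) }
  where
  open PrimeFactorisation (factorise ∣ s ∣ {{ℕ.≢-nonZero (s≢0 ∘ ℤ.∣i∣≡0⇒i≡0)}})
  open ≡-Reasoning
  σ = ℤ.sign s ℤ.◃ 1
  k′ = map (σ ℤ.*_) k

  eq′ : ∀ x → + ∣ s ∣ ℤ.* eval f x ≡ eval k′ x ℤ.* eval h x
  eq′ x = begin
    + ∣ s ∣ ℤ.* eval f x             ≡⟨ cong (ℤ._* eval f x) (+∣i∣≡sign◃1*i s) ⟩
    σ ℤ.* s ℤ.* eval f x             ≡⟨ ℤ.*-assoc σ s (eval f x) ⟩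
    σ ℤ.* (s ℤ.* eval f x)           ≡⟨ cong (σ ℤ.*_) (eq x) ⟩
    σ ℤ.* (eval k x ℤ.* eval h x)    ≡⟨ ℤ.*-assoc σ (eval k x) (eval h x) ⟨
    σ ℤ.* eval k x ℤ.* eval h x      ≡⟨ cong (ℤ._* eval h x) (eval-scale σ k x) ⟨
    eval k′ x ℤ.* eval h x ∎

content : Poly → ℕ
content []      = 0
content (a ∷ p) = gcd ∣ a ∣ (content p)

content-∣ᶜ : ∀ p → + content p ∣ᶜ p
content-∣ᶜ []      i       = divides 0ℤ refl
content-∣ᶜ (a ∷ p) zero    = ℤ.∣ᵤ⇒∣ (gcd[m,n]∣m ∣ a ∣ (content p))
content-∣ᶜ (a ∷ p) (suc i) =
  ℤ.∣-trans (ℤ.∣ᵤ⇒∣ (gcd[m,n]∣n ∣ a ∣ (content p))) (content-∣ᶜ p i)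

content-greatest : ∀ {c} p → + c ∣ᶜ p → c ℕ.∣ content p
content-greatest []      c∣p = _ ℕ.∣0
content-greatest (a ∷ p) c∣p = gcd-greatest (ℤ.∣⇒∣ᵤ (c∣p 0)) (content-greatest p (c∣p ∘ suc))

content≡0⇒eval≡0 : ∀ p → content p ≡ 0 → ∀ x → eval p x ≡ 0ℤ
content≡0⇒eval≡0 p c≡0 =
  coeff≡0⇒eval≡0 p λ i → ℤ.0∣⇒≡0 (subst (λ c → + c ∣ₛ coeff p i) c≡0 (content-∣ᶜ p i))

-- If a prime π divided the quotient p′, then `content p` times π would divide every coefficient of
-- p, hence `content p` itself, which forces π = 1.
primitive-part : ∀ p → content p ≢ 0 →
  ∃[ p′ ] Primitive p′ × (∀ x → eval p x ≡ + content p ℤ.* eval p′ x)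
primitive-part p c≢0 with ∣ᶜ-divide (+ content p) p (content-∣ᶜ p)
... | p′ , p≡cp′ = p′ , p′-primitive , p≡cp′
  where
  c = content p
  instance
    c-nonZero : ℕ.NonZero c
    c-nonZero = ℕ.≢-nonZero c≢0

  coeff-≡c* : ∀ i → coeff p i ≡ + c ℤ.* coeff p′ i
  coeff-≡c* i = trans (coeff-≡ (pointwise⇒≈ p (map (+ c ℤ.*_) p′)
    λ x → trans (p≡cp′ x) (sym (eval-scale (+ c) p′ x))) i) (coeff-scale (+ c) p′ i)

  p′-primitive : Primitive p′
  p′-primitive {π} π-prime π∣p′ = contradiction (subst Prime π≡1 π-prime) ¬prime[1]
    where
    cπ∣c : c * π ℕ.∣ c * 1
    cπ∣c = subst (c * π ℕ.∣_) (sym (ℕ.*-identityʳ c)) (content-greatest p λ i →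
      subst₂ _∣ₛ_ (sym (ℤ.pos-* c π)) (sym (coeff-≡c* i)) (ℤ.*-monoʳ-∣ (+ c) (π∣p′ i)))
    π≡1 : π ≡ 1
    π≡1 = ℕ.∣1⇒≡1 (ℕ.*-cancelˡ-∣ c cπ∣c)

eval-±1ₚ : ∀ {p} → p ≈ 1ₚ ⊎ p ≈ -ₚ 1ₚ → ∃[ ε ] ε ≢ 0ℤ × (∀ x → eval p x ≡ ε)
eval-±1ₚ (inj₁ p≈1)  = 1ℤ , (λ ()) , λ x → trans (≈⇒pointwise p≈1 x) (cong (λ z → 1ℤ ℤ.+ z) (ℤ.*-zeroʳ x))
eval-±1ₚ (inj₂ p≈-1) = ℤ.-1ℤ , (λ ()) , λ x →
  trans (≈⇒pointwise p≈-1 x) (cong (λ z → ℤ.-1ℤ ℤ.+ z) (ℤ.*-zeroʳ x))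

-- The pseudo-gcd h is its content times a primitive polynomial h′ dividing both p and q, so h′ is
-- ±1 and h is constant. The point where p does not vanish guarantees that h, and with it the
-- constant, is nonzero.
bezout : ∀ p q → NoCommonFactor p q → ∃[ x ] eval p x ≢ 0ℤ →
  ∃[ u ] ∃[ v ] ∃[ r ] r ≢ 0ℤ × (∀ x → eval u x ℤ.* eval p x ℤ.+ eval v x ℤ.* eval q x ≡ r)
bezout p q coprime (x₀ , px₀≢0) =
  u , v , + content h ℤ.* ε , cε≢0 , λ x →
    trans (sym (combination x)) (trans (h≡ch′ x) (cong (+ content h ℤ.*_) (h′≡ε x)))
  where
  open PseudoGcd (pseudoGcd p q)
  open ≡-Reasoning

  content≢0 : content h ≢ 0
  content≢0 c≡0 = [ s≢0 , px₀≢0 ]′ (ℤ.i*j≡0⇒i≡0∨j≡0 s (begin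
    s ℤ.* eval p x₀          ≡⟨ h∣sp x₀ ⟩
    eval k x₀ ℤ.* eval h x₀  ≡⟨ cong (eval k x₀ ℤ.*_) (content≡0⇒eval≡0 h c≡0 x₀) ⟩
    eval k x₀ ℤ.* 0ℤ         ≡⟨ ℤ.*-zeroʳ (eval k x₀) ⟩
    0ℤ ∎))

  h-parts = primitive-part h content≢0
  h′ = proj₁ h-parts
  h′-primitive : Primitive h′
  h′-primitive = proj₁ (proj₂ h-parts)
  h≡ch′ = proj₂ (proj₂ h-parts)

  h′∣ : ∀ f g → (∀ x → s ℤ.* eval f x ≡ eval g x ℤ.* eval h x) → h′ ∣ₚ f
  h′∣ f g eq = primitive-∣ h′ h′-primitive s s≢0 f (map (+ content h ℤ.*_) g) λ x → begin
    s ℤ.* eval f x                                    ≡⟨ eq x ⟩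
    eval g x ℤ.* eval h x                             ≡⟨ cong (eval g x ℤ.*_) (h≡ch′ x) ⟩
    eval g x ℤ.* (+ content h ℤ.* eval h′ x)          ≡⟨ regroup (eval g x) (+ content h) (eval h′ x) ⟩
    + content h ℤ.* eval g x ℤ.* eval h′ x            ≡⟨ cong (ℤ._* eval h′ x) (eval-scale (+ content h) g x) ⟨
    eval (map (+ content h ℤ.*_) g) x ℤ.* eval h′ x ∎
    where
    regroup : ∀ a b c → a ℤ.* (b ℤ.* c) ≡ b ℤ.* a ℤ.* c
    regroup = solve-∀

  unit = eval-±1ₚ (coprime h′ (h′∣ p k h∣sp) (h′∣ q l h∣sq))
  ε = proj₁ unit
  ε≢0 = proj₁ (proj₂ unit)
  h′≡ε = proj₂ (proj₂ unit)

  cε≢0 : + content h ℤ.* ε ≢ 0ℤ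
  cε≢0 = [ content≢0 ∘ ℤ.+-injective , ε≢0 ]′ ∘ ℤ.i*j≡0⇒i≡0∨j≡0 (+ content h)

-- Radicals and the ABC-Conjecture

^-distribʳ-* : ∀ m n k → (m * n) ^ k ≡ m ^ k * n ^ k
^-distribʳ-* m n zero    = refl
^-distribʳ-* m n (suc k) =
  trans (cong (m * n *_) (^-distribʳ-* m n k)) (interchange m n (m ^ k) (n ^ k))
  where
  interchange : ∀ a b c d → a * b * (c * d) ≡ a * c * (b * d)
  interchange = ℕ.solve-∀

abs-^ : ∀ i k → ∣ i ℤ.^ k ∣ ≡ ∣ i ∣ ^ k
abs-^ i zero    = refl
abs-^ i (suc k) = trans (ℤ.abs-* i (i ℤ.^ k)) (cong (∣ i ∣ *_) (abs-^ i k))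

abs-eval-*ₚ : ∀ p q x → ∣ eval (p *ₚ q) x ∣ ≡ ∣ eval p x ∣ * ∣ eval q x ∣
abs-eval-*ₚ p q x = trans (cong ∣_∣ (eval-*ₚ p q x)) (ℤ.abs-* (eval p x) (eval q x))

abs-eval-^ₚ : ∀ p k x → ∣ eval (p ^ₚ k) x ∣ ≡ ∣ eval p x ∣ ^ k
abs-eval-^ₚ p k x = trans (cong ∣_∣ (eval-^ₚ p k x)) (abs-^ (eval p x) k)

-- The exponent e is the sum of all the `es i`, hence at least each of them. It does not depend on
-- x, which later makes the bound on common divisors uniform.
∏^-∣-∏-power : ∀ {n} (ps : Vector Poly n) (es : Vector ℕ n) →
  ∃[ e ] (∀ x → ∣ eval (∏^ ps es) x ∣ ℕ.∣ ∣ eval (∏ ps) x ∣ ^ e)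
∏^-∣-∏-power {zero}  ps es = 0 , λ x → ℕ.∣-reflexive (abs-eval-^ₚ 1ₚ 0 x)
∏^-∣-∏-power {suc n} ps es with ∏^-∣-∏-power (ps ∘ suc) (es ∘ suc)
... | e , divs = k + e , λ x → subst₂ ℕ._∣_
  (sym (trans (abs-eval-*ₚ (p ^ₚ k) (∏^ (ps ∘ suc) (es ∘ suc)) x)
    (cong (_* ∣ eval (∏^ (ps ∘ suc) (es ∘ suc)) x ∣) (abs-eval-^ₚ p k x))))
  (cong (_^ (k + e)) (sym (abs-eval-*ₚ p (∏ (ps ∘ suc)) x)))
  (enlarge (∣ eval p x ∣) (divs x))
  where
  p = ps zero
  k = es zero
  enlarge : ∀ a {b c} → b ℕ.∣ c ^ e → a ^ k * b ℕ.∣ (a * c) ^ (k + e)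
  enlarge a {b} {c} b∣cᵉ rewrite ^-distribʳ-* a c (k + e) | ℕ.^-distribˡ-+-* a k e | ℕ.^-distribˡ-+-* c k e =
    ℕ.*-pres-∣ {o = a ^ k} {p = b} (ℕ.m∣m*n (a ^ e)) (ℕ.∣n⇒∣m*n (c ^ k) b∣cᵉ)

-- Serves to show that G(y) is nonzero when g(y) is; the exponents must be positive for a factor to
-- divide its power.
∏-∣-∏^ : ∀ {n} (ps : Vector Poly n) (es : Vector ℕ n) → (∀ i → 0 < es i) →
  ∀ x → ∣ eval (∏ ps) x ∣ ℕ.∣ ∣ eval (∏^ ps es) x ∣
∏-∣-∏^ {zero}  ps es es>0 x = ℕ.∣-refl
∏-∣-∏^ {suc n} ps es es>0 x = subst₂ ℕ._∣_
  (sym (abs-eval-*ₚ p (∏ (ps ∘ suc)) x))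
  (sym (trans (abs-eval-*ₚ (p ^ₚ es zero) (∏^ (ps ∘ suc) (es ∘ suc)) x)
    (cong (_* ∣ eval (∏^ (ps ∘ suc) (es ∘ suc)) x ∣) (abs-eval-^ₚ p (es zero) x))))
  (ℕ.*-pres-∣ (m∣m^k (es>0 zero)) (∏-∣-∏^ (ps ∘ suc) (es ∘ suc) (es>0 ∘ suc) x))
  where
  p = ps zero
  m∣m^k : ∀ {m k} → 0 < k → m ℕ.∣ m ^ k
  m∣m^k {m} {suc k} _ = ℕ.m∣m*n (m ^ k)

-- Every term of the expansion of (a + b)^(i + j) contains a^i or b^j. Instead of expanding at once,
-- one factor a + b is split at a time, and s collects the factors already chosen.
∣^⇒∣+^ : ∀ {d} s a b i j → d ∣ₛ s ℤ.* a ℤ.^ i → d ∣ₛ s ℤ.* b ℤ.^ j → d ∣ₛ s ℤ.* (a ℤ.+ b) ℤ.^ (i + j)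
∣^⇒∣+^ {d} s a b zero j d∣s _ =
  ℤ.∣m⇒∣m*n _ (subst (d ∣ₛ_) (ℤ.*-identityʳ s) d∣s)
∣^⇒∣+^ {d} s a b (suc i) zero _ d∣s =
  ℤ.∣m⇒∣m*n _ (subst (d ∣ₛ_) (ℤ.*-identityʳ s) d∣s)
∣^⇒∣+^ {d} s a b (suc i) (suc j) d∣saⁱ d∣sbʲ =
  subst (d ∣ₛ_) (collect s a b ((a ℤ.+ b) ℤ.^ (i + suc j))) (ℤ.∣m∣n⇒∣m+n
    (∣^⇒∣+^ (s ℤ.* a) a b i (suc j)
      (subst (d ∣ₛ_) (sym (ℤ.*-assoc s a (a ℤ.^ i))) d∣saⁱ)
      (subst (d ∣ₛ_) (swap a s (b ℤ.^ suc j)) (ℤ.∣n⇒∣m*n a d∣sbʲ)))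
    (subst (λ k → d ∣ₛ s ℤ.* b ℤ.* (a ℤ.+ b) ℤ.^ k) (sym (ℕ.+-suc i j))
      (∣^⇒∣+^ (s ℤ.* b) a b (suc i) j
        (subst (d ∣ₛ_) (swap b s (a ℤ.^ suc i)) (ℤ.∣n⇒∣m*n b d∣saⁱ))
        (subst (d ∣ₛ_) (sym (ℤ.*-assoc s b (b ℤ.^ j))) d∣sbʲ))))
  where
  swap : ∀ a s c → a ℤ.* (s ℤ.* c) ≡ s ℤ.* a ℤ.* c
  swap = solve-∀
  collect : ∀ s a b c → s ℤ.* a ℤ.* c ℤ.+ s ℤ.* b ℤ.* c ≡ s ℤ.* ((a ℤ.+ b) ℤ.* c)
  collect = solve-∀

-- Here r = u p + v q, and d divides both (u p)^i and (v q)^j.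
common-divisor-of-powers : ∀ u v {p q r} i j → u ℤ.* p ℤ.+ v ℤ.* q ≡ r →
  ∀ d → d ℕ.∣ ∣ p ∣ ^ i → d ℕ.∣ ∣ q ∣ ^ j → d ℕ.∣ ∣ r ∣ ^ (i + j)
common-divisor-of-powers u v {p} {q} i j refl d d∣pⁱ d∣qʲ =
  subst (d ℕ.∣_) (trans (cong ∣_∣ (ℤ.*-identityˡ ((u ℤ.* p ℤ.+ v ℤ.* q) ℤ.^ (i + j)))) (abs-^ (u ℤ.* p ℤ.+ v ℤ.* q) (i + j)))
    (ℤ.∣⇒∣ᵤ (∣^⇒∣+^ 1ℤ (u ℤ.* p) (v ℤ.* q) i j (lift u p i d∣pⁱ) (lift v q j d∣qʲ)))
  where
  lift : ∀ u p i → d ℕ.∣ ∣ p ∣ ^ i → + d ∣ₛ 1ℤ ℤ.* (u ℤ.* p) ℤ.^ i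
  lift u p i d∣pⁱ rewrite ℤ.*-identityˡ ((u ℤ.* p) ℤ.^ i) = ℤ.∣ᵤ⇒∣ (subst (d ℕ.∣_)
    (sym (trans (abs-^ (u ℤ.* p) i) (trans (cong (_^ i) (ℤ.abs-* u p)) (^-distribʳ-* ∣ u ∣ ∣ p ∣ i))))
    (ℕ.∣n⇒∣m*n (∣ u ∣ ^ i) d∣pⁱ))

prime-∣^ : ∀ {π} m k → Prime π → π ℕ.∣ m ^ k → π ℕ.∣ m
prime-∣^ m zero    π-prime π∣1 = contradiction (subst Prime (ℕ.∣1⇒≡1 π∣1) π-prime) ¬prime[1]
prime-∣^ m (suc k) π-prime π∣  = [ id , prime-∣^ m k π-prime ]′ (euclidsLemma m (m ^ k) π-prime π∣)

-- By induction M = q times the product of the remaining primes. The new prime π divides q, for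
-- otherwise it would divide that product and so be one of its factors, against distinctness.
product-distinct-primes-∣ : ∀ {πs M} → Unique πs → All Prime πs → All (ℕ._∣ M) πs → ℕ.product πs ℕ.∣ M
product-distinct-primes-∣ [] [] [] = ℕ.1∣ _
product-distinct-primes-∣ {π ∷ πs} (π∉πs ∷ unique) (π-prime ∷ primes) (π∣M ∷ πs∣M)
  with product-distinct-primes-∣ unique primes πs∣M
... | ℕ.divides q refl with euclidsLemma q (ℕ.product πs) π-prime π∣M
...   | inj₁ π∣q = ℕ.*-monoˡ-∣ (ℕ.product πs) π∣q
...   | inj₂ π∣Π = contradiction refl (All.lookup π∉πs (factorisationHasAllPrimeFactors π-prime π∣Π primes))

N-∣ : ∀ a b c {M} → (∀ π → Prime π → π ℕ.∣ a * b * c → π ℕ.∣ M) → N a b c ℕ.∣ M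
N-∣ a b c {M} abc-primes∣M = product-distinct-primes-∣
  (filter⁺ P? (upTo⁺ (suc (a * b * c)))) (All.map proj₁ selected)
  (All.map (λ {π} (π-prime , π∣abc) → abc-primes∣M π π-prime π∣abc) selected)
  where
  P? = λ π → prime? π ×-dec π ℕ.∣? a * b * c
  selected = all-filter P? (upTo (suc (a * b * c)))

-- The inequality of the ABC-Conjecture for one ε = p / q and its constant C.
record ABCBound (C q p : ℕ) : Set where
  constructor mkABCBound
  field
    bound : ∀ a b c → 0 < a → 0 < b → 0 < c → gcd (gcd a b) c ≡ 1 → a + b ≡ c →
            c ^ q ≤ C ^ q * N a b c ^ (q + p)

m*n>0⇒n>0 : ∀ m {n} → 0 < m * n → 0 < n
m*n>0⇒n>0 m {zero}  m*0>0 = contradiction (ℕ.*-zeroʳ m) (ℕ.>⇒≢ m*0>0)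
m*n>0⇒n>0 m {suc n} _     = s≤s z≤n

-- Divide the equation by d = gcd a b. Since d divides r, the lost factor d^q is at most r^q and
-- goes into the constant; the primes of the quotients are still primes of a b c, so their radical
-- divides M.
abc-up-to-gcd : ∀ {C q p} → ABCBound C q p → ∀ r M → 0 < r → 0 < M → ∀ a b c → 0 < a → 0 < b → a + b ≡ c →
  (∀ d → d ℕ.∣ a → d ℕ.∣ b → d ℕ.∣ r) →
  (∀ π → Prime π → π ℕ.∣ a * b * c → π ℕ.∣ M) →
  c ^ q ≤ (C * r) ^ q * M ^ (q + p)
abc-up-to-gcd {C} {q} {p} abc r M r>0 M>0 a b c a>0 b>0 refl gcd∣r primes∣M
  with gcd a b in gcd≡d | gcd[m,n]∣m a b | gcd[m,n]∣n a b
... | d | ℕ.divides a′ refl | ℕ.divides b′ refl = begin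
  (a′ * d + b′ * d) ^ q              ≡⟨ cong (_^ q) c≡dc′ ⟩
  (d * c′) ^ q                       ≡⟨ ^-distribʳ-* d c′ q ⟩
  d ^ q * c′ ^ q                     ≤⟨ ℕ.*-mono-≤ (ℕ.^-monoˡ-≤ q d≤r) (ABCBound.bound abc a′ b′ c′ a′>0 b′>0
                                          (ℕ.<-≤-trans a′>0 (ℕ.m≤m+n a′ b′)) coprime refl) ⟩
  r ^ q * (C ^ q * N a′ b′ c′ ^ (q + p)) ≤⟨ ℕ.*-monoʳ-≤ (r ^ q) (ℕ.*-monoʳ-≤ (C ^ q) (ℕ.^-monoˡ-≤ (q + p) N≤M)) ⟩
  r ^ q * (C ^ q * M ^ (q + p))      ≡⟨ regroup (r ^ q) (C ^ q) (M ^ (q + p)) ⟩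
  C ^ q * r ^ q * M ^ (q + p)        ≡⟨ cong (_* M ^ (q + p)) (^-distribʳ-* C r q) ⟨
  (C * r) ^ q * M ^ (q + p) ∎
  where
  open ℕ.≤-Reasoning
  c′ = a′ + b′
  regroup : ∀ a b c → a * (b * c) ≡ b * a * c
  regroup = ℕ.solve-∀

  c≡dc′ : a′ * d + b′ * d ≡ d * c′
  c≡dc′ = trans (sym (ℕ.*-distribʳ-+ d a′ b′)) (ℕ.*-comm c′ d)

  d>0 : 0 < d
  d>0 = m*n>0⇒n>0 a′ a>0
  instance
    d-nonZero : ℕ.NonZero d
    d-nonZero = ℕ.>-nonZero d>0

  a′>0 : 0 < a′
  a′>0 = m*n>0⇒n>0 d (subst (0 <_) (ℕ.*-comm a′ d) a>0)
  b′>0 : 0 < b′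
  b′>0 = m*n>0⇒n>0 d (subst (0 <_) (ℕ.*-comm b′ d) b>0)

  d≤r : d ≤ r
  d≤r = ℕ.∣⇒≤ {{ℕ.>-nonZero r>0}} (gcd∣r d (ℕ.n∣m*n a′) (ℕ.n∣m*n b′))

  coprime : gcd (gcd a′ b′) c′ ≡ 1
  coprime = trans (cong (λ g → gcd g c′) (ℕ.*-cancelˡ-≡ (gcd a′ b′) 1 d (trans
    (c*gcd[m,n]≡gcd[cm,cn] d a′ b′)
    (trans (cong₂ gcd (ℕ.*-comm d a′) (ℕ.*-comm d b′)) (trans gcd≡d (sym (ℕ.*-identityʳ d)))))))
    (gcd-zeroˡ c′)

  N≤M : N a′ b′ c′ ≤ M
  N≤M = ℕ.∣⇒≤ {{ℕ.>-nonZero M>0}} (N-∣ a′ b′ c′ λ π π-prime π∣ → primes∣M π π-prime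
    (ℕ.∣-trans π∣ (ℕ.*-pres-∣ {o = a′ * b′} {p = c′} (ℕ.*-pres-∣ {o = a′} {p = b′} (ℕ.m∣m*n d) (ℕ.m∣m*n d))
      (subst (c′ ℕ.∣_) (sym c≡dc′) (ℕ.n∣m*n d)))))

-- What a signed relation between three integers leaves for their absolute values, once each term is
-- moved to the side where it is nonnegative.
LargestIsSum : ℕ → ℕ → ℕ → Set
LargestIsSum a b c = a + b ≡ c ⊎ a + c ≡ b ⊎ b + c ≡ a

∣m⊖n∣-largest : ∀ m n → m + ∣ m ℤ.⊖ n ∣ ≡ n ⊎ n + ∣ m ℤ.⊖ n ∣ ≡ m
∣m⊖n∣-largest m n with ℕ.≤-total m n
... | inj₁ m≤n rewrite ℤ.∣⊖∣-≤ m≤n = inj₁ (ℕ.m+[n∸m]≡n m≤n)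
... | inj₂ n≤m rewrite ℤ.∣m⊖n∣≡∣n⊖m∣ m n | ℤ.∣⊖∣-≤ n≤m = inj₂ (ℕ.m+[n∸m]≡n n≤m)

largestIsSum : ∀ i j → LargestIsSum (∣ i ∣) (∣ j ∣) (∣ i ℤ.+ j ∣)
largestIsSum (+ m)        (+ n)        = inj₁ refl
largestIsSum (+ m)        (ℤ.-[1+ n ]) = inj₂ (∣m⊖n∣-largest m (suc n))
largestIsSum (ℤ.-[1+ m ]) (+ n)        rewrite ℤ.∣m⊖n∣≡∣n⊖m∣ n (suc m) = inj₂ (∣m⊖n∣-largest (suc m) n)
largestIsSum (ℤ.-[1+ m ]) (ℤ.-[1+ n ]) = inj₁ (cong suc (ℕ.+-suc m n))

-- Whichever term is the largest, c is at most that term. A common divisor of two terms also divides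
-- the third, so the condition on common divisors of a and b carries over.
abc-largestIsSum : ∀ {C q p} → ABCBound C q p → ∀ r M → 0 < r → 0 < M →
  ∀ a b c → 0 < a → 0 < b → 0 < c → LargestIsSum a b c →
  (∀ d → d ℕ.∣ a → d ℕ.∣ b → d ℕ.∣ r) →
  (∀ π → Prime π → π ℕ.∣ a * b * c → π ℕ.∣ M) →
  c ^ q ≤ (C * r) ^ q * M ^ (q + p)
abc-largestIsSum abc r M r>0 M>0 a b c a>0 b>0 c>0 (inj₁ a+b≡c) gcd∣r primes∣M =
  abc-up-to-gcd abc r M r>0 M>0 a b c a>0 b>0 a+b≡c gcd∣r primes∣M
abc-largestIsSum {q = q} abc r M r>0 M>0 a b c a>0 b>0 c>0 (inj₂ (inj₁ refl)) gcd∣r primes∣M =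
  ℕ.≤-trans (ℕ.^-monoˡ-≤ q (ℕ.m≤n+m c a))
    (abc-up-to-gcd abc r M r>0 M>0 a c b a>0 c>0 refl
      (λ d d∣a d∣c → gcd∣r d d∣a (ℕ.∣m∣n⇒∣m+n d∣a d∣c))
      (λ π π-prime π∣acb → primes∣M π π-prime (subst (π ℕ.∣_) (swap a c b) π∣acb)))
  where
  swap : ∀ a b c → a * b * c ≡ a * c * b
  swap = ℕ.solve-∀
abc-largestIsSum {q = q} abc r M r>0 M>0 a b c a>0 b>0 c>0 (inj₂ (inj₂ refl)) gcd∣r primes∣M =
  ℕ.≤-trans (ℕ.^-monoˡ-≤ q (ℕ.m≤n+m c b))
    (abc-up-to-gcd abc r M r>0 M>0 b c a b>0 c>0 refl
      (λ d d∣b d∣c → gcd∣r d (ℕ.∣m∣n⇒∣m+n d∣b d∣c) d∣b)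
      (λ π π-prime π∣bca → primes∣M π π-prime (subst (π ℕ.∣_) (rotate b c a) π∣bca)))
  where
  rotate : ∀ b c a → b * c * a ≡ a * b * c
  rotate = ℕ.solve-∀

-- Bounding the solutions

largestIsSum-± : ∀ s p q x →
  LargestIsSum (∣ eval p x ∣) (∣ eval q x ∣) (∣ eval (p ±[ s ] q) x ∣)
largestIsSum-± Sign.+ p q x rewrite eval-+ₚ p q x = largestIsSum (eval p x) (eval q x)
largestIsSum-± Sign.- p q x rewrite eval-+ₚ p (-ₚ q) x | eval--ₚ q x =
  subst (λ b → LargestIsSum (∣ eval p x ∣) b (∣ eval p x ℤ.+ ℤ.- eval q x ∣)) (ℤ.∣-i∣≡∣i∣ (eval q x))
    (largestIsSum (eval p x) (ℤ.- eval q x))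

abc-exponent-1+1/D : ABC-Conjecture → ∀ D → 0 < D → ∃[ C ] ABCBound C D 1
abc-exponent-1+1/D abc (suc d) _ =
  -- `mkℚ` stores the denominator minus one, so this is ε = 1 / (d + 1) = 1 / D.
  let C , bound = abc (mkℚ (+ 1) d (ℕ.1-coprimeTo (suc d))) (positive⁻¹ _) in C , mkABCBound bound

eventually-nonzero : ∀ p → NonZeroₚ p → ∃[ B ] (∀ x → B ≤ ∣ x ∣ → 0 < ∣ eval p x ∣)
eventually-nonzero p p≢0 =
  let K , B , bound = lower-bound p p≢0
  in suc B , λ x B<X → m*n>0⇒n>0 K (ℕ.<-≤-trans
       (ℕ.m^n>0 (∣ x ∣) {{ℕ.>-nonZero (ℕ.≤-trans (s≤s z≤n) B<X)}} (deg p)) (bound x (ℕ.<⇒≤ B<X)))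

-- If |y| > |x|, then |y|^(deg f + 1) ≤ |y|^(deg g) ≤ K |g(y)| = K |f(x)| ≤ K L |y|^(deg f). Hence
-- |y| ≤ K L, which contradicts |y| > |x| ≥ K L.
equal-values-bound : ∀ f g → deg f < deg g →
  ∃[ B ] (∀ x y → B ≤ ∣ x ∣ → eval f x ≡ eval g y → ∣ y ∣ ≤ ∣ x ∣)
equal-values-bound f g deg< with upper-bound f | lower-bound g (deg>0⇒nonZero g (ℕ.≤-trans (s≤s z≤n) deg<))
... | L , upper | K , B , lower = B + K * L , λ x y big fx≡gy → ℕ.≮⇒≥ λ X<Y →
  let Y = ∣ y ∣
      instance
        Y-nonZero : ℕ.NonZero Y
        Y-nonZero = ℕ.>-nonZero (ℕ.≤-trans (s≤s z≤n) X<Y)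
        Y^D-nonZero : ℕ.NonZero (Y ^ deg f)
        Y^D-nonZero = ℕ.m^n≢0 Y (deg f)
      Y≤KL = ℕ.*-cancelʳ-≤ Y (K * L) (Y ^ deg f) (begin
        Y * Y ^ deg f          ≤⟨ ℕ.^-monoʳ-≤ Y deg< ⟩
        Y ^ deg g              ≤⟨ lower y (ℕ.≤-trans (ℕ.m≤m+n B (K * L)) (ℕ.≤-trans big (ℕ.<⇒≤ X<Y))) ⟩
        K * ∣ eval g y ∣       ≡⟨ cong (λ z → K * ∣ z ∣) fx≡gy ⟨
        K * ∣ eval f x ∣       ≤⟨ ℕ.*-monoʳ-≤ K (upper Y x (ℕ.≤-trans (s≤s z≤n) X<Y) (ℕ.<⇒≤ X<Y)) ⟩
        K * (L * Y ^ deg f)    ≡⟨ ℕ.*-assoc K L _ ⟨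
        K * L * Y ^ deg f ∎)
  in ℕ.<⇒≱ X<Y (ℕ.≤-trans Y≤KL (ℕ.≤-trans (ℕ.m≤n+m (K * L) B) big))
  where open ℕ.≤-Reasoning

bounded-value⇒bounded : ∀ g → 0 < deg g → ∀ V → ∃[ B ] (∀ y → ∣ eval g y ∣ ≤ V → ∣ y ∣ ≤ B)
bounded-value⇒bounded g deg>0 V with lower-bound g (deg>0⇒nonZero g deg>0)
... | K , B , lower = B + K * V , bound
  where
  open ℕ.≤-Reasoning
  m≤m^k : ∀ m {k} → 0 < k → m ≤ m ^ k
  m≤m^k zero    _   = z≤n
  m≤m^k (suc m) k>0 = ℕ.≤-trans (ℕ.≤-reflexive (sym (ℕ.^-identityʳ (suc m)))) (ℕ.^-monoʳ-≤ (suc m) k>0)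
  bound : ∀ y → ∣ eval g y ∣ ≤ V → ∣ y ∣ ≤ B + K * V
  bound y gy≤V with ℕ.≤-total B (∣ y ∣)
  ... | inj₂ Y≤B = ℕ.≤-trans Y≤B (ℕ.m≤m+n B (K * V))
  ... | inj₁ B≤Y = begin
    ∣ y ∣                ≤⟨ m≤m^k ∣ y ∣ deg>0 ⟩
    ∣ y ∣ ^ deg g        ≤⟨ lower y B≤Y ⟩
    K * ∣ eval g y ∣     ≤⟨ ℕ.*-monoʳ-≤ K gy≤V ⟩
    K * V                ≤⟨ ℕ.m≤n+m (K * V) B ⟩
    B + K * V ∎

integersUpTo : ℕ → List ℤ
integersUpTo B = map +_ (upTo (suc B)) ++ map (λ n → ℤ.- + n) (upTo (suc B))

∈-integersUpTo : ∀ {B} x → ∣ x ∣ ≤ B → x ∈ integersUpTo B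
∈-integersUpTo (+ n)        n≤B = ∈-++⁺ˡ (∈-map⁺ +_ (∈-upTo⁺ (s≤s n≤B)))
∈-integersUpTo {B} (ℤ.-[1+ n ]) n<B = ∈-++⁺ʳ (map +_ (upTo (suc B))) (∈-map⁺ (λ n → ℤ.- + n) (∈-upTo⁺ (s≤s n<B)))

bounded⇒finite : ∀ {P : Pred (ℤ × ℤ) 0ℓ} → Decidable P → ∀ B₁ B₂ →
  (∀ x y → P (x , y) → ∣ x ∣ ≤ B₁ × ∣ y ∣ ≤ B₂) → Finite P
bounded⇒finite P? B₁ B₂ bounded =
  filter P? (cartesianProduct (integersUpTo B₁) (integersUpTo B₂)) , λ (x , y) → mk⇔
    (λ z∈ → proj₂ (∈-filter⁻ P? {xs = cartesianProduct (integersUpTo B₁) (integersUpTo B₂)} z∈))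
    (λ Pz → let x≤B₁ , y≤B₂ = bounded x y Pz in
      ∈-filter⁺ P? (∈-cartesianProduct⁺ (∈-integersUpTo x x≤B₁) (∈-integersUpTo y y≤B₂)) Pz)

-- The exponents are compared through 1 + E(D + 1) ≤ D², valid as E ≤ D − 2.
exponent-gap⇒bounded : ∀ {D E K W L} X c M → 0 < X → 1 + E < D →
  X ^ D ≤ K * c → c ^ D ≤ W * M ^ (D + 1) → M ≤ L * X ^ E →
  X ≤ K ^ D * (W * L ^ (D + 1))
exponent-gap⇒bounded {D} {E} {K} {W} {L} X c M X>0 gap X^D≤Kc abc M≤LX^E =
  ℕ.*-cancelʳ-≤ X _ (X ^ (E * (D + 1))) (begin
    X * X ^ (E * (D + 1))                           ≤⟨ ℕ.^-monoʳ-≤ X (exponents gap) ⟩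
    X ^ (D * D)                                     ≡⟨ ℕ.^-*-assoc X D D ⟨
    (X ^ D) ^ D                                     ≤⟨ ℕ.^-monoˡ-≤ D X^D≤Kc ⟩
    (K * c) ^ D                                     ≡⟨ ^-distribʳ-* K c D ⟩
    K ^ D * c ^ D                                   ≤⟨ ℕ.*-monoʳ-≤ (K ^ D) abc ⟩
    K ^ D * (W * M ^ (D + 1))                       ≤⟨ ℕ.*-monoʳ-≤ (K ^ D) (ℕ.*-monoʳ-≤ W (ℕ.^-monoˡ-≤ (D + 1) M≤LX^E)) ⟩
    K ^ D * (W * (L * X ^ E) ^ (D + 1))             ≡⟨ cong (λ z → K ^ D * (W * z)) (^-distribʳ-* L (X ^ E) (D + 1)) ⟩
    K ^ D * (W * (L ^ (D + 1) * (X ^ E) ^ (D + 1))) ≡⟨ cong (λ z → K ^ D * (W * (L ^ (D + 1) * z))) (ℕ.^-*-assoc X E (D + 1)) ⟩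
    K ^ D * (W * (L ^ (D + 1) * X ^ (E * (D + 1)))) ≡⟨ regroup (K ^ D) W (L ^ (D + 1)) (X ^ (E * (D + 1))) ⟩
    K ^ D * (W * L ^ (D + 1)) * X ^ (E * (D + 1)) ∎)
  where
  open ℕ.≤-Reasoning
  instance
    X-nonZero : ℕ.NonZero X
    X-nonZero = ℕ.>-nonZero X>0
    X^-nonZero : ℕ.NonZero (X ^ (E * (D + 1)))
    X^-nonZero = ℕ.m^n≢0 X (E * (D + 1))
  regroup : ∀ a b c d → a * (b * (c * d)) ≡ a * (b * c) * d
  regroup = ℕ.solve-∀
  exponents : ∀ {D} → 1 + E < D → suc (E * (D + 1)) ≤ D * D
  exponents gap with ℕ.m≤n⇒∃[o]m+o≡n gap
  -- With D = 2 + E + o, the difference of the two sides is a polynomial in E and o with nonnegative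
  -- coefficients.
  ... | o , refl = subst (suc (E * (2 + E + o + 1)) ≤_) (square E o) (ℕ.m≤m+n _ (3 + E + 4 * o + E * o + o * o))
    where
    square : ∀ e o → suc (e * (2 + e + o + 1)) + (3 + e + 4 * o + e * o + o * o) ≡ (2 + e + o) * (2 + e + o)
    square = ℕ.solve-∀

-- For |y| ≤ |x| the value q(y) is bounded by a multiple of |x|^(deg q), hence of |q(x)|. This
-- reduces the claim to the growth of p q at x alone and avoids computing the degree of a product.
mixed-product-bound : ∀ p q → NonZeroₚ q →
  ∃[ L ] ∃[ B ] (∀ x y → B ≤ ∣ x ∣ → ∣ y ∣ ≤ ∣ x ∣ →
    ∣ eval p x ∣ * ∣ eval q y ∣ ≤ L * ∣ x ∣ ^ deg (p *ₚ q))
mixed-product-bound p q q≢0 with upper-bound q | lower-bound q q≢0 | upper-bound (p *ₚ q)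
... | L , q-upper | K , B , q-lower | L′ , pq-upper = L * K * L′ , suc B , bound
  where
  open ℕ.≤-Reasoning
  bound : ∀ x y → B < ∣ x ∣ → ∣ y ∣ ≤ ∣ x ∣ → ∣ eval p x ∣ * ∣ eval q y ∣ ≤ L * K * L′ * ∣ x ∣ ^ deg (p *ₚ q)
  bound x y B<X Y≤X = begin
    P * ∣ eval q y ∣                     ≤⟨ ℕ.*-monoʳ-≤ P (q-upper X y X>0 Y≤X) ⟩
    P * (L * X ^ deg q)                  ≤⟨ ℕ.*-monoʳ-≤ P (ℕ.*-monoʳ-≤ L (q-lower x (ℕ.<⇒≤ B<X))) ⟩
    P * (L * (K * ∣ eval q x ∣))         ≡⟨ regroup P L K ∣ eval q x ∣ ⟩
    L * K * (P * ∣ eval q x ∣)           ≡⟨ cong (L * K *_) (abs-eval-*ₚ p q x) ⟨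
    L * K * ∣ eval (p *ₚ q) x ∣          ≤⟨ ℕ.*-monoʳ-≤ (L * K) (pq-upper X x X>0 ℕ.≤-refl) ⟩
    L * K * (L′ * X ^ deg (p *ₚ q))      ≡⟨ ℕ.*-assoc (L * K) L′ _ ⟨
    L * K * L′ * X ^ deg (p *ₚ q) ∎
    where
    X = ∣ x ∣
    P = ∣ eval p x ∣
    X>0 : 0 < X
    X>0 = ℕ.≤-trans (s≤s z≤n) B<X
    regroup : ∀ p l k q → p * (l * (k * q)) ≡ l * k * (p * q)
    regroup = ℕ.solve-∀

solutions-bounded-x : ∀ f g p q → deg f < deg g → 1 + deg (p *ₚ q) < deg f → NonZeroₚ q → ∀ W B →
  (∀ x y → B ≤ ∣ x ∣ → eval f x ≡ eval g y →
    ∣ eval f x ∣ ^ deg f ≤ W * (∣ eval p x ∣ * ∣ eval q y ∣) ^ (deg f + 1)) →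
  ∃[ B′ ] (∀ x y → eval f x ≡ eval g y → ∣ x ∣ ≤ B′)
solutions-bounded-x f g p q deg< gap q≢0 W B₁ abc
  with equal-values-bound f g deg< | lower-bound f (deg>0⇒nonZero f (ℕ.≤-trans (s≤s z≤n) gap))
     | mixed-product-bound p q q≢0
... | B₂ , Y≤X | K , B₃ , f-lower | L , B₄ , pq-upper = threshold + bound , bounded
  where
  -- Beyond all four thresholds, with `suc` to make |x| positive.
  threshold = suc (B₁ + B₂ + (B₃ + B₄))
  bound = K ^ deg f * (W * L ^ (deg f + 1))

  large⇒bounded : ∀ x y → threshold ≤ ∣ x ∣ → eval f x ≡ eval g y → ∣ x ∣ ≤ bound
  large⇒bounded x y large fx≡gy =
    exponent-gap⇒bounded {deg f} {deg (p *ₚ q)} {K} {W} {L} (∣ x ∣) (∣ eval f x ∣) (∣ eval p x ∣ * ∣ eval q y ∣)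
      (ℕ.≤-trans (s≤s z≤n) large) gap
      (f-lower x (ℕ.≤-trans (ℕ.m≤m+n B₃ B₄) B₃+B₄≤X))
      (abc x y (ℕ.≤-trans (ℕ.m≤m+n B₁ B₂) B₁+B₂≤X) fx≡gy)
      (pq-upper x y (ℕ.≤-trans (ℕ.m≤n+m B₄ B₃) B₃+B₄≤X)
        (Y≤X x y (ℕ.≤-trans (ℕ.m≤n+m B₂ B₁) B₁+B₂≤X) fx≡gy))
    where
    B₁+B₂≤X = ℕ.≤-trans (ℕ.m≤m+n (B₁ + B₂) (B₃ + B₄)) (ℕ.<⇒≤ large)
    B₃+B₄≤X = ℕ.≤-trans (ℕ.m≤n+m (B₃ + B₄) (B₁ + B₂)) (ℕ.<⇒≤ large)

  bounded : ∀ x y → eval f x ≡ eval g y → ∣ x ∣ ≤ threshold + bound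
  bounded x y fx≡gy with ℕ.≤-total threshold (∣ x ∣)
  ... | inj₁ large = ℕ.≤-trans (large⇒bounded x y large fx≡gy) (ℕ.m≤n+m bound threshold)
  ... | inj₂ small = ℕ.≤-trans small (ℕ.m≤m+n threshold bound)

solutions-finite : ∀ f g → 0 < deg g → ∀ B → (∀ x y → eval f x ≡ eval g y → ∣ x ∣ ≤ B) →
  Finite (λ ((x , y) : ℤ × ℤ) → eval f x ≡ eval g y)
solutions-finite f g deg>0 B x-bounded with upper-bound f
-- `suc B` replaces B because `upper-bound` asks for a positive X.
... | L , f-upper with bounded-value⇒bounded g deg>0 (L * suc B ^ deg f)
...   | B′ , y-bounded = bounded⇒finite (λ (x , y) → eval f x ℤ.≟ eval g y) B B′ λ x y fx≡gy →
  let X≤B = x-bounded x y fx≡gy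
  in X≤B , y-bounded y (subst (λ z → ∣ z ∣ ≤ L * suc B ^ deg f) fx≡gy
       (f-upper (suc B) x (s≤s z≤n) (ℕ.m≤n⇒m≤1+n X≤B)))

-- The ABC-Conjecture at solutions of f(x) = g(y)

prime-∣-∏^⇒∣-∏ : ∀ {n π} (ps : Vector Poly n) es x → Prime π →
  π ℕ.∣ ∣ eval (∏^ ps es) x ∣ → π ℕ.∣ ∣ eval (∏ ps) x ∣
prime-∣-∏^⇒∣-∏ ps es x π-prime π∣ =
  let e , divs = ∏^-∣-∏-power ps es in prime-∣^ _ e π-prime (ℕ.∣-trans π∣ (divs x))

∏^>0 : ∀ {n} (ps : Vector Poly n) es x → 0 < ∣ eval (∏ ps) x ∣ → 0 < ∣ eval (∏^ ps es) x ∣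
∏^>0 ps es x ∏>0 = ℕ.n≢0⇒n>0 λ ∏^≡0 →
  let e , divs = ∏^-∣-∏-power ps es
  in ℕ.>⇒≢ (ℕ.m^n>0 (∣ eval (∏ ps) x ∣) {{ℕ.>-nonZero ∏>0}} e)
       (ℕ.0∣⇒≡0 (subst (ℕ._∣ ∣ eval (∏ ps) x ∣ ^ e) ∏^≡0 (divs x)))

module _
  {l m n} (f₁ : Vector Poly l) (f₂ : Vector Poly m) (gs : Vector Poly n)
  (α : Vector ℕ l) (β : Vector ℕ m) (γ : Vector ℕ n) (γ>0 : ∀ k → 0 < γ k) (s : Sign)
  where

  private
    F₁ = ∏ f₁
    F₂ = ∏ f₂
    G  = ∏ gs
    f  = ∏^ f₁ α ±[ s ] ∏^ f₂ β
    g  = ∏^ gs γ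

  -- The three terms are the two products of powers and f(x). The equation enters through the last
  -- one: the primes of f(x) = g(y) divide G(y), so the radical is controlled by F₁(x) F₂(x) G(y).
  abc-at-solution : ∀ {C q p} → ABCBound C q p → ∀ r → 0 < r → ∀ x y →
    (∀ d → d ℕ.∣ ∣ eval (∏^ f₁ α) x ∣ → d ℕ.∣ ∣ eval (∏^ f₂ β) x ∣ → d ℕ.∣ r) →
    0 < ∣ eval F₁ x ∣ → 0 < ∣ eval F₂ x ∣ → 0 < ∣ eval f x ∣ → eval f x ≡ eval g y →
    ∣ eval f x ∣ ^ q ≤ (C * r) ^ q * (∣ eval (F₁ *ₚ F₂) x ∣ * ∣ eval G y ∣) ^ (q + p)
  abc-at-solution abc r r>0 x y gcd∣r F₁x>0 F₂x>0 fx>0 fx≡gy =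
    abc-largestIsSum abc r (∣ eval (F₁ *ₚ F₂) x ∣ * ∣ eval G y ∣) r>0 M>0 _ _ _
      (∏^>0 f₁ α x F₁x>0) (∏^>0 f₂ β x F₂x>0) fx>0 (largestIsSum-± s (∏^ f₁ α) (∏^ f₂ β) x) gcd∣r primes∣M
    where
    Gy>0 : 0 < ∣ eval G y ∣
    Gy>0 = ℕ.n≢0⇒n>0 λ Gy≡0 → ℕ.>⇒≢ fx>0
      (trans (cong ∣_∣ fx≡gy) (ℕ.0∣⇒≡0 (subst (ℕ._∣ ∣ eval g y ∣) Gy≡0 (∏-∣-∏^ gs γ γ>0 y))))

    M>0 : 0 < ∣ eval (F₁ *ₚ F₂) x ∣ * ∣ eval G y ∣
    M>0 rewrite abs-eval-*ₚ F₁ F₂ x = ℕ.*-mono-< (ℕ.*-mono-< F₁x>0 F₂x>0) Gy>0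

    primes∣M : ∀ π → Prime π →
      π ℕ.∣ ∣ eval (∏^ f₁ α) x ∣ * ∣ eval (∏^ f₂ β) x ∣ * ∣ eval f x ∣ →
      π ℕ.∣ ∣ eval (F₁ *ₚ F₂) x ∣ * ∣ eval G y ∣
    primes∣M π π-prime π∣ rewrite abs-eval-*ₚ F₁ F₂ x =
      [ [ (λ π∣A → ℕ.∣m⇒∣m*n _ (ℕ.∣m⇒∣m*n _ (prime-∣-∏^⇒∣-∏ f₁ α x π-prime π∣A)))
        , (λ π∣B → ℕ.∣m⇒∣m*n _ (ℕ.∣n⇒∣m*n (∣ eval F₁ x ∣) (prime-∣-∏^⇒∣-∏ f₂ β x π-prime π∣B)))
        ]′ ∘ euclidsLemma (∣ eval (∏^ f₁ α) x ∣) (∣ eval (∏^ f₂ β) x ∣) π-prime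
      , (λ π∣fx → ℕ.∣n⇒∣m*n (∣ eval F₁ x ∣ * ∣ eval F₂ x ∣)
          (prime-∣-∏^⇒∣-∏ gs γ y π-prime (subst (λ z → π ℕ.∣ ∣ z ∣) fx≡gy π∣fx)))
      ]′ (euclidsLemma (∣ eval (∏^ f₁ α) x ∣ * ∣ eval (∏^ f₂ β) x ∣) (∣ eval f x ∣) π-prime π∣)

  -- For large |x| none of F₁(x), F₂(x), f(x) vanishes. Common divisors of the two terms divide r, a
  -- power of the Bézout constant ρ that is independent of x, so the factor W is uniform in the
  -- solution.
  abc-at-large-solutions : 0 < deg f → NoCommonFactor F₁ F₂ → NonZeroₚ F₁ → NonZeroₚ F₂ → ABC-Conjecture →
    ∃[ W ] ∃[ B ] (∀ x y → B ≤ ∣ x ∣ → eval f x ≡ eval g y →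
      ∣ eval f x ∣ ^ deg f ≤ W * (∣ eval (F₁ *ₚ F₂) x ∣ * ∣ eval G y ∣) ^ (deg f + 1))
  abc-at-large-solutions deg-f>0 coprime F₁≢0 F₂≢0 abc =
    let B₁ , F₁>0 = eventually-nonzero F₁ F₁≢0
        B₂ , F₂>0 = eventually-nonzero F₂ F₂≢0
        B₃ , f>0  = eventually-nonzero f (deg>0⇒nonZero f deg-f>0)
        C , abcBound = abc-exponent-1+1/D abc (deg f) deg-f>0
        e₁ , A∣ = ∏^-∣-∏-power f₁ α
        e₂ , B∣ = ∏^-∣-∏-power f₂ β
        u , v , ρ , ρ≢0 , uF₁+vF₂≡ρ =
          -- B₁ itself is a point at which F₁ does not vanish.
          bezout F₁ F₂ coprime (+ B₁ , λ F₁≡0 → ℕ.>⇒≢ (F₁>0 (+ B₁) ℕ.≤-refl) (cong ∣_∣ F₁≡0))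
        r = ∣ ρ ∣ ^ (e₁ + e₂)
    in (C * r) ^ deg f , B₁ + B₂ + B₃ , λ x y large fx≡gy →
      let ≥B₃   = ℕ.≤-trans (ℕ.m≤n+m B₃ (B₁ + B₂)) large
          B₁+B₂≤ = ℕ.≤-trans (ℕ.m≤m+n (B₁ + B₂) B₃) large
      in abc-at-solution abcBound r
        (ℕ.m^n>0 (∣ ρ ∣) {{ℕ.≢-nonZero (ρ≢0 ∘ ℤ.∣i∣≡0⇒i≡0)}} (e₁ + e₂)) x y
        (λ d d∣A d∣B → common-divisor-of-powers (eval u x) (eval v x) e₁ e₂ (uF₁+vF₂≡ρ x) d
          (ℕ.∣-trans d∣A (A∣ x)) (ℕ.∣-trans d∣B (B∣ x)))
        (F₁>0 x (ℕ.≤-trans (ℕ.m≤m+n B₁ B₂) B₁+B₂≤)) (F₂>0 x (ℕ.≤-trans (ℕ.m≤n+m B₂ B₁) B₁+B₂≤))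
        (f>0 x ≥B₃) fx≡gy

theorem1p5 : (l m n : ℕ) → 0 < l → 0 < m → 0 < n →
    (f₁ : Vector Poly l) (f₂ : Vector Poly m) (gs : Vector Poly n) →
    (α : Vector ℕ l) (β : Vector ℕ m) (γ : Vector ℕ n) →
    (∀ i → 0 < α i) → (∀ j → 0 < β j) → (∀ k → 0 < γ k) →
    (s : Sign) →
    let f = ∏^ f₁ α ±[ s ] ∏^ f₂ β
        g = ∏^ gs γ
    in
    deg f < deg g →
    1 + deg (∏ f₁ *ₚ ∏ f₂ *ₚ ∏ gs) < deg f →
    NoCommonFactor (∏ f₁) (∏ f₂) →
    0ℤ ℤ.< leadingCoeff (∏ f₁) →
    0ℤ ℤ.< leadingCoeff (∏ f₂) →
    0ℤ ℤ.< leadingCoeff (∏ gs) →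
    ABC-Conjecture →
    Finite (λ ((x , y) : ℤ × ℤ) → eval f x ≡ eval g y)
theorem1p5 l m n _ _ _ f₁ f₂ gs α β γ _ _ γ>0 s deg< gap coprime lc₁>0 lc₂>0 lc₃>0 abc =
  let f = ∏^ f₁ α ±[ s ] ∏^ f₂ β
      g = ∏^ gs γ
      F₁≢0 = leadingCoeff>0⇒nonZero (∏ f₁) lc₁>0
      F₂≢0 = leadingCoeff>0⇒nonZero (∏ f₂) lc₂>0
      G≢0  = leadingCoeff>0⇒nonZero (∏ gs) lc₃>0
      W , B , abc-bound = abc-at-large-solutions f₁ f₂ gs α β γ γ>0 s
        (ℕ.≤-trans (s≤s z≤n) gap) coprime F₁≢0 F₂≢0 abc
      B′ , x-bounded = solutions-bounded-x f g (∏ f₁ *ₚ ∏ f₂) (∏ gs) deg< gap G≢0 W B abc-bound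
  in solutions-finite f g (ℕ.≤-trans (s≤s z≤n) deg<) B′ x-bounded
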